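{- Let $\mu\subseteq\lambda$ be partitions with $\lambda\neq\varnothing$, let $n\ge1$ be an integer, and suppose that $s_{\lambda/\mu}(x_1,\ldots,x_n)\neq0$. For every integer $R\ge\lambda_1$ let $$E_R=C_{n,R}(\lambda/\mu)=(R^n,\mu)/\lambda,\qquad \kappa_R=(R,\ldots,R)\in\mathbb Z_{\ge0}^n.$$ Then $s_{E_R}(x_1,\ldots,x_n)\neq0$, every $\alpha\in\operatorname{supp}(s_{E_R}(x_1,\ldots,x_n))$ satisfies $\alpha\le\kappa_R$, and $$\mathcal N\bigl(s_{\lambda/\mu}(x_1,\ldots,x_n)\bigr)=\bigl(s_{E_R}(x_1,\ldots,x_n)\bigr)^{\vee,\kappa_R}.$$
   Context: Partitions are extended by zero parts whenever necessary, and $\mu\subseteq\lambda$ means $\mu_i\le\lambda_i$ for all $i$. The skew shape $\lambda/\mu$ is the set of boxes $(i,j)$ with $i\ge 1$ and $\mu_i<j\le\lambda_i$ (English notation: rows $i$ numbered from top to bottom, columns $j$ from left to right). A semistandard tableau of skew shape $D$ is a filling of the boxes of $D$ by positive integers, weakly increasing along rows and strictly increasing down columns. The skew Schur polynomial is $s_D(x_1,\ldots,x_n)=\sum_T x_1^{m_1(T)}\cdots x_n^{m_n(T)}$, where $T$ ranges over semistandard tableaux of shape $D$ with entries in $\{1,\ldots,n\}$ and $m_i(T)$ is the number of entries of $T$ equal to $i$. For integers $n,R\ge1$ and a partition $\mu$ with $\mu_1\le R$, $(R^n,\mu)$ denotes the concatenated partition $(R,\ldots,R,\mu_1,\mu_2,\ldots)$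 with $n$ initial parts equal to $R$. Whenever $\lambda\subseteq(R^n,\mu)$, the rectangular complement is $C_{n,R}(\lambda/\mu)=(R^n,\mu)/\lambda$; under the hypotheses of the claim this containment holds, so $E_R$ is a well-defined skew shape. For $\alpha\in\mathbb Z_{\ge0}^n$ put $x^\alpha=x_1^{\alpha_1}\cdots x_n^{\alpha_n}$, $\alpha!=\alpha_1!\cdots\alpha_n!$; $\alpha\le\kappa$ means coordinatewise inequality. For a polynomial $f=\sum_\alpha c_\alpha x^\alpha$, $\operatorname{supp}(f)=\{\alpha:c_\alpha\ne0\}$ and $\mathcal N(f)=\sum_\alpha\frac{c_\alpha}{\alpha!}x^\alpha$. If $\alpha\le\kappa$ for every $\alpha\in\operatorname{supp}(f)$, then $$f^{\vee,\kappa}=\mathcal N\bigl(x^\kappa f(x_1^{ -1},\ldots,x_n^{ -1})\bigr)=\sum_{\alpha\le\kappa}\frac{c_\alpha}{(\kappa-\alpha)!}x^{\kappa-\alpha}.$$ -}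

module Defs where

open import Data.Bool.Base using (if_then_else_)
open import Data.Nat.Base as ℕ
  using (ℕ; zero; suc; _∸_; _≤_; _<_; _≥_; _!; NonZero)
import Data.Nat.Properties as ℕₚ
open import Data.Integer.Base using (+_)
open import Data.Rational as ℚ using (ℚ; 0ℚ; 1ℚ)
import Data.Rational.Properties as ℚₚ
open import Data.Fin.Base as Fin using (Fin)
import Data.Fin.Properties as Finₚ
open import Data.List.Base as List using (List; []; _∷_; _++_; length)
open import Data.List.Membership.Propositional using (_∈_)
open import Data.List.Membership.Propositional.Properties using (∈-map⁺; ∈-++⁺ˡ; ∈-++⁺ʳ)
open import Data.List.Relation.Unary.All using (All; []; _∷_)
open import Data.List.Relation.Unary.Any using (here)
open import Data.List.Relation.Unary.Linked using (Linked; []; [-]; _∷_)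
open import Data.Vec.Base as Vec using (Vec; []; _∷_)
import Data.Vec.Properties as Vecₚ
open import Data.Vec.Relation.Binary.Pointwise.Inductive as Pointwise
  using (Pointwise; []; _∷_)
open import Data.Product.Base using (_×_; _,_; ∃-syntax; proj₁; proj₂)
open import Relation.Nullary using (¬_; Dec; does; yes; no; contradiction)
open import Relation.Nullary.Decidable using (_×-dec_; _→-dec_)
open import Relation.Unary using (Decidable)
open import Relation.Binary.PropositionalEquality
  using (_≡_; _≢_; refl; trans; cong; cong₂; subst)

infix 4 _⊆_ _≤ᵉ_ _≤ᵉ?_ _≈_ _≉0 _∈supp_
infixl 6 _+ᴾ_
infix 8 _!ᵉ

------------------------------------------------------------------------
-- Partitions and skew shapes

record Partition : Set where
  constructor mkPartition
  field
    parts      : List ℕ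
    decreasing : Linked _≥_ parts
    positive   : All (0 <_) parts

open Partition public

∅ : Partition
∅ = mkPartition [] [] []

nth : List ℕ → ℕ → ℕ
nth []       _       = 0
nth (x ∷ xs) zero    = x
nth (x ∷ xs) (suc i) = nth xs i

-- Rows, columns and tableau entries are all counted from 0, so `part λ i`
-- is the (i+1)-st part of λ; it is 0 beyond the last positive part.
part : Partition → ℕ → ℕ
part p = nth (parts p)

_⊆_ : Partition → Partition → Set
μ ⊆ ν = ∀ i → part μ i ≤ part ν i

record SkewShape : Set where
  constructor skew
  field
    outer inner : Partition
    inner⊆outer : inner ⊆ outer

open SkewShape public

-- The boxes (i , j) with inner i ≤ j < outer i, each listed once.
boxes : SkewShape → List (ℕ × ℕ)
boxes D = List.concatMap row (List.upTo (length (parts (outer D))))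
  where
  row : ℕ → List (ℕ × ℕ)
  row i = List.applyUpTo (λ k → i , part (inner D) i ℕ.+ k)
                         (part (outer D) i ∸ part (inner D) i)

private
  prepend : ∀ {x xs} → nth xs 0 ≤ x → Linked _≥_ xs → Linked _≥_ (x ∷ xs)
  prepend {xs = []}    _   _  = [-]
  prepend {xs = _ ∷ _} y≤x ds = y≤x ∷ ds

  rect-head : ∀ n {R xs} → nth xs 0 ≤ R → nth (List.replicate n R ++ xs) 0 ≤ R
  rect-head zero    h = h
  rect-head (suc n) h = ℕₚ.≤-refl

  rect-decreasing : ∀ n {R xs} → nth xs 0 ≤ R → Linked _≥_ xs →
                    Linked _≥_ (List.replicate n R ++ xs)
  rect-decreasing zero    h ds = ds
  rect-decreasing (suc n) h ds = prepend (rect-head n h) (rect-decreasing n h ds)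

  rect-positive : ∀ n {R xs} → 0 < R → All (0 <_) xs →
                  All (0 <_) (List.replicate n R ++ xs)
  rect-positive zero    h ps = ps
  rect-positive (suc n) h ps = h ∷ rect-positive n h ps

-- The concatenated partition (Rⁿ, μ).
rect : ∀ n R (μ : Partition) → 1 ≤ R → part μ 0 ≤ R → Partition
rect n R μ 1≤R μ₁≤R = mkPartition
  (List.replicate n R ++ parts μ)
  (rect-decreasing n μ₁≤R (decreasing μ))
  (rect-positive n 1≤R (positive μ))

-- The rectangular complement of ν/μ, namely (Rⁿ, μ)/ν.
complement : ∀ n R (D : SkewShape) (1≤R : 1 ≤ R) (μ₁≤R : part (inner D) 0 ≤ R) →
             outer D ⊆ rect n R (inner D) 1≤R μ₁≤R → SkewShape
complement n R D 1≤R μ₁≤R c = skew (rect n R (inner D) 1≤R μ₁≤R) (outer D) c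

≢∅⇒1≤ : ∀ {ν R} → ν ≢ ∅ → part ν 0 ≤ R → 1 ≤ R
≢∅⇒1≤ {mkPartition []      []   []}      ν≢∅ _    = contradiction refl ν≢∅
≢∅⇒1≤ {mkPartition (_ ∷ _) _    (p ∷ _)} _   ν₁≤R = ℕₚ.≤-trans p ν₁≤R

------------------------------------------------------------------------
-- Exponent vectors

Exponent : ℕ → Set
Exponent n = Vec ℕ n

_≤ᵉ_ : ∀ {n} → Exponent n → Exponent n → Set
_≤ᵉ_ = Pointwise _≤_

_≤ᵉ?_ : ∀ {n} (α κ : Exponent n) → Dec (α ≤ᵉ κ)
_≤ᵉ?_ = Pointwise.decidable ℕₚ._≤?_

_≟ᵉ_ : ∀ {n} (α β : Exponent n) → Dec (α ≡ β)
_≟ᵉ_ = Vecₚ.≡-dec ℕₚ._≟_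

_∸ᵉ_ : ∀ {n} → Exponent n → Exponent n → Exponent n
_∸ᵉ_ = Vec.zipWith _∸_

_!ᵉ : ∀ {n} → Exponent n → ℕ
[]      !ᵉ = 1
(a ∷ α) !ᵉ = a ! ℕ.* α !ᵉ

fact≢0 : ∀ {n} (α : Exponent n) → NonZero (α !ᵉ)
fact≢0 []      = _
fact≢0 (a ∷ α) = ℕₚ.m*n≢0 (a !) (α !ᵉ) {{a ℕₚ.!≢0}} {{fact≢0 α}}

κ∸[κ∸α]≡α : ∀ {n} {α κ : Exponent n} → α ≤ᵉ κ → κ ∸ᵉ (κ ∸ᵉ α) ≡ α
κ∸[κ∸α]≡α []       = refl
κ∸[κ∸α]≡α (p ∷ ps) = cong₂ _∷_ (ℕₚ.m∸[m∸n]≡n p) (κ∸[κ∸α]≡α ps)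

------------------------------------------------------------------------
-- Polynomials over ℚ in n variables: finitely supported coefficient
-- functions, compared by `_≈_`

record Poly (n : ℕ) : Set where
  constructor mkPoly
  field
    coeff  : Exponent n → ℚ
    finite : ∃[ L ] (∀ α → coeff α ≢ 0ℚ → α ∈ L)

open Poly public

_≈_ : ∀ {n} → Poly n → Poly n → Set
f ≈ g = ∀ α → coeff f α ≡ coeff g α

_∈supp_ : ∀ {n} → Exponent n → Poly n → Set
α ∈supp f = coeff f α ≢ 0ℚ

0ᴾ : ∀ {n} → Poly n
0ᴾ = mkPoly (λ _ → 0ℚ) ([] , λ _ 0≢0 → contradiction refl 0≢0)

_≉0 : ∀ {n} → Poly n → Set
f ≉0 = ¬ (f ≈ 0ᴾ)

_+ᴾ_ : ∀ {n} → Poly n → Poly n → Poly n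
mkPoly f (L , f∈L) +ᴾ mkPoly g (M , g∈M) =
  mkPoly (λ α → f α ℚ.+ g α) (L ++ M , bound)
  where
  bound : ∀ α → f α ℚ.+ g α ≢ 0ℚ → α ∈ L ++ M
  bound α s≢0 with f α ℚₚ.≟ 0ℚ | g α ℚₚ.≟ 0ℚ
  ... | no f≢0  | _       = ∈-++⁺ˡ (f∈L α f≢0)
  ... | yes _   | no g≢0  = ∈-++⁺ʳ L (g∈M α g≢0)
  ... | yes f≡0 | yes g≡0 =
    contradiction (trans (cong₂ ℚ._+_ f≡0 g≡0) (ℚₚ.+-identityˡ 0ℚ)) s≢0

monomial : ∀ {n} → Exponent n → Poly n
monomial {n} α = mkPoly c (α ∷ [] , bound)
  where
  c : Exponent n → ℚ
  c β = if does (β ≟ᵉ α) then 1ℚ else 0ℚ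

  bound : ∀ β → c β ≢ 0ℚ → β ∈ α ∷ []
  bound β c≢0 with β ≟ᵉ α
  ... | yes β≡α = here β≡α
  ... | no  _   = contradiction refl c≢0

sumᴾ : ∀ {n} → List (Poly n) → Poly n
sumᴾ = List.foldr _+ᴾ_ 0ᴾ

-- The operator 𝒩, dividing the coefficient of x^α by α!.
normalize : ∀ {n} → Poly n → Poly n
normalize (mkPoly f (L , f∈L)) = mkPoly
  (λ α → f α ℚ.* inv α)
  (L , λ α s≢0 → f∈L α λ f≡0 →
    s≢0 (trans (cong (ℚ._* inv α) f≡0) (ℚₚ.*-zeroˡ (inv α))))
  where
  inv : Exponent _ → ℚ
  inv α = (+ 1 ℚ./ (α !ᵉ)) {{fact≢0 α}}

-- x^κ f(x₁⁻¹, …, xₙ⁻¹).  Terms x^α of f with α ≰ κ would become non-polynomial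
-- and are dropped, so this is meaningful only when every α ∈supp f has α ≤ᵉ κ.
reciprocal : ∀ {n} → Exponent n → Poly n → Poly n
reciprocal {n} κ (mkPoly f (L , f∈L)) = mkPoly c (List.map (κ ∸ᵉ_) L , bound)
  where
  c : Exponent n → ℚ
  c β = if does (β ≤ᵉ? κ) then f (κ ∸ᵉ β) else 0ℚ

  bound : ∀ β → c β ≢ 0ℚ → β ∈ List.map (κ ∸ᵉ_) L
  bound β c≢0 with β ≤ᵉ? κ
  ... | yes β≤κ = subst (_∈ List.map (κ ∸ᵉ_) L) (κ∸[κ∸α]≡α β≤κ)
                        (∈-map⁺ (κ ∸ᵉ_) (f∈L (κ ∸ᵉ β) c≢0))
  ... | no  _   = contradiction refl c≢0

-- f^{∨,κ}
dual : ∀ {n} → Exponent n → Poly n → Poly n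
dual κ f = normalize (reciprocal κ f)

------------------------------------------------------------------------
-- Semistandard tableaux and skew Schur polynomials

-- A filling of D assigns an entry to each position in the list `boxes D`;
-- the element t of Fin n stands for the entry t+1 ∈ {1, …, n}.
Filling : ℕ → SkewShape → Set
Filling n D = Vec (Fin n) (length (boxes D))

module _ {n : ℕ} (D : SkewShape) where

  rowOf colOf : Fin (length (boxes D)) → ℕ
  rowOf a = proj₁ (List.lookup (boxes D) a)
  colOf a = proj₂ (List.lookup (boxes D) a)

  Semistandard : Filling n D → Set
  Semistandard T = ∀ a b →
    (rowOf a ≡ rowOf b → colOf a < colOf b → Vec.lookup T a Fin.≤ Vec.lookup T b) ×
    (colOf a ≡ colOf b → rowOf a < rowOf b → Vec.lookup T a Fin.< Vec.lookup T b)

  semistandard? : Decidable Semistandard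
  semistandard? T = Finₚ.all? λ a → Finₚ.all? λ b →
    ((rowOf a ℕₚ.≟ rowOf b) →-dec ((colOf a ℕₚ.<? colOf b) →-dec
      (Vec.lookup T a Finₚ.≤? Vec.lookup T b)))
    ×-dec
    ((colOf a ℕₚ.≟ colOf b) →-dec ((rowOf a ℕₚ.<? rowOf b) →-dec
      (Vec.lookup T a Finₚ.<? Vec.lookup T b)))

-- All words of length m in the alphabet Fin n, each listed once.
words : ∀ n m → List (Vec (Fin n) m)
words n zero    = [] ∷ []
words n (suc m) = List.cartesianProductWith _∷_ (List.allFin n) (words n m)

tableaux : ∀ n D → List (Filling n D)
tableaux n D = List.filter (semistandard? D) (words n (length (boxes D)))

content : ∀ {n m} → Vec (Fin n) m → Exponent n
content T = Vec.tabulate λ t → Vec.count (Finₚ._≟ t) T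

schur : ∀ n → SkewShape → Poly n
schur n D = sumᴾ (List.map (λ T → monomial (content T)) (tableaux n D))

{-# OPTIONS --safe #-}
module Submission where

open import Defs
open import Data.Empty using (⊥)
open import Data.Fin.Base as Fin using (Fin; toℕ; fromℕ<)
import Data.Fin.Properties as Finₚ
open import Data.List.Base as List
  using (List; []; _∷_; _++_; length; filter; concatMap; upTo; applyUpTo; applyDownFrom)
open import Data.List.Membership.Propositional using (_∈_; find; lose)
open import Data.List.Membership.Propositional.Properties
open import Data.List.Properties using (filter-++; length-++; reverse-applyUpTo; length-applyUpTo)
open import Data.List.Relation.Binary.Disjoint.Propositional using (Disjoint)
open import Data.List.Relation.Binary.Permutation.Propositional as ↭ using (_↭_; ↭-sym)
open import Data.List.Relation.Binary.Permutation.Propositional.Properties using (↭-reverse; ↭-length)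
open import Data.List.Relation.Unary.All as All using (All; []; _∷_)
import Data.List.Relation.Unary.All.Properties as Allₚ
open import Data.List.Relation.Unary.AllPairs as AllPairs using (AllPairs; []; _∷_)
import Data.List.Relation.Unary.AllPairs.Properties as AllPairsₚ
open import Data.List.Relation.Unary.Any as Any using (here; there)
open import Data.List.Relation.Unary.Any.Properties using (lookup-index)
open import Data.List.Relation.Unary.Linked using (Linked; []; [-]; _∷_)
open import Data.List.Relation.Unary.Unique.Propositional using (Unique)
import Data.List.Relation.Unary.Unique.Propositional.Properties as Uniqueₚ
open import Data.Nat.Base
open import Data.Nat.Properties
open import Data.Nat.Solver using (module +-*-Solver)
open import Data.Product.Base using (_×_; _,_; ∃-syntax; Σ-syntax; proj₁; proj₂)
open import Data.Rational as ℚ using (ℚ; 0ℚ; 1ℚ)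
import Data.Rational.Properties as ℚₚ
open import Data.Sum.Base using (_⊎_; inj₁; inj₂)
open import Data.Vec.Base as Vec using (Vec; []; _∷_; toList; replicate)
import Data.Vec.Properties as Vecₚ
open import Data.Vec.Relation.Binary.Pointwise.Inductive using ([]; _∷_)
open import Function.Base using (_∘_; _$_; id)
open import Level using (0ℓ)
open import Relation.Binary.PropositionalEquality
open import Relation.Nullary using (¬_; yes; no; contradiction)
open import Relation.Nullary.Decidable using (decidable-stable)
open import Relation.Unary using (Pred; Decidable)

-- A semistandard tableau of shape ν/μ with entries in {1, …, n} is a chain
-- μ = g₀ ⊆ g₁ ⊆ … ⊆ gₙ = ν of horizontal strips, the sizes of the strips being the content.
-- If κ/μ is a horizontal strip of size a and κ₁ ≤ R, then (R, μ)/κ is one of size R − a, so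
-- ν = gₙ ⊆ (R, gₙ₋₁) ⊆ (R², gₙ₋₂) ⊆ … ⊆ (Rⁿ, g₀) is a chain for the rectangular complement,
-- and every chain for the complement arises in this way.  Its content is R minus the content
-- of g in reverse order; the reversal is undone by Bender–Knuth involutions.

-- No factorial is ever computed: the coefficients of x^α on both sides are divided by the same α!,
-- so the claim reduces to counting. For α ≤ κ there must be as many tableaux of content α on ν/μ as
-- of content κ - α on the complement; for other α both coefficients vanish. Chains are functions on
-- all of ℕ whose values past `n` carry no information and which are compared only pointwise. The
-- two counts are therefore matched by one injection in each direction, judged by `_≗[ n ]_`, rather
-- than by a pair of inverse maps. Nonvanishing of the Schur polynomial enters through column
-- lengths: n strips put at most n boxes into a column, and this makes ν fit into (Rⁿ, μ).

Row : Set
Row = ℕ → ℕ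

infixr 5 _◂_

_◂_ : ℕ → Row → Row
(a ◂ μ) zero    = a
(a ◂ μ) (suc i) = μ i

-- Partial sums of row lengths.

sum< : ℕ → Row → ℕ
sum< zero    f = 0
sum< (suc m) f = f 0 + sum< m (f ∘ suc)

sum<-cong : ∀ m {f g : Row} → f ≗ g → sum< m f ≡ sum< m g
sum<-cong zero    f≗g = refl
sum<-cong (suc m) f≗g = cong₂ _+_ (f≗g 0) (sum<-cong m (f≗g ∘ suc))

sum<-mono : ∀ m {f g : Row} → (∀ i → f i ≤ g i) → sum< m f ≤ sum< m g
sum<-mono zero    f≤g = z≤n
sum<-mono (suc m) f≤g = +-mono-≤ (f≤g 0) (sum<-mono m (f≤g ∘ suc))

sum<-+ : ∀ m (f g : Row) → sum< m (λ i → f i + g i) ≡ sum< m f + sum< m g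
sum<-+ zero    f g = refl
sum<-+ (suc m) f g = begin
  f 0 + g 0 + sum< m (λ i → f (suc i) + g (suc i))        ≡⟨ cong (f 0 + g 0 +_) (sum<-+ m (f ∘ suc) (g ∘ suc)) ⟩
  f 0 + g 0 + (sum< m (f ∘ suc) + sum< m (g ∘ suc))       ≡⟨ solve 4 (λ a b c d → a :+ b :+ (c :+ d) := (a :+ c) :+ (b :+ d)) refl (f 0) (g 0) _ _ ⟩
  f 0 + sum< m (f ∘ suc) + (g 0 + sum< m (g ∘ suc))       ∎
  where open ≡-Reasoning
        open +-*-Solver

sum<-split : ∀ s m (f : Row) → sum< (s + m) f ≡ sum< s f + sum< m (λ i → f (s + i))
sum<-split zero    m f = refl
sum<-split (suc s) m f = trans (cong (f 0 +_) (sum<-split s m (f ∘ suc))) (sym (+-assoc (f 0) _ _))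

sum<-last : ∀ m (f : Row) → sum< (suc m) f ≡ sum< m f + f m
sum<-last m f = begin
  sum< (suc m) f               ≡⟨ cong (λ k → sum< k f) (+-comm 1 m) ⟩
  sum< (m + 1) f               ≡⟨ sum<-split m 1 f ⟩
  sum< m f + (f (m + 0) + 0)   ≡⟨ cong (sum< m f +_) (trans (+-identityʳ _) (cong f (+-identityʳ m))) ⟩
  sum< m f + f m               ∎
  where open ≡-Reasoning

sum<-const : ∀ m {f : Row} {R} → (∀ i → i < m → f i ≡ R) → sum< m f ≡ m * R
sum<-const zero    f≡R = refl
sum<-const (suc m) f≡R = cong₂ _+_ (f≡R 0 z<s) (sum<-const m λ i i<m → f≡R (suc i) (s<s i<m))

sum<-support : ∀ {ℓ m} {f : Row} → (∀ i → ℓ ≤ i → f i ≡ 0) → ℓ ≤ m → sum< m f ≡ sum< ℓ f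
sum<-support {zero}  {m}     f≡0 _         = trans (sum<-const m λ i _ → f≡0 i z≤n) (*-zeroʳ m)
sum<-support {suc ℓ} {suc m} f≡0 (s≤s ℓ≤m) = cong (_ +_) (sum<-support (λ i → f≡0 (suc i) ∘ s≤s) ℓ≤m)

-- Horizontal strips and their chains.

-- κ/μ is a horizontal strip of a boxes, and κ has at most ℓ positive parts.
record Step (ℓ : ℕ) (μ κ : Row) (a : ℕ) : Set where
  field
    lower     : ∀ i → μ i ≤ κ i
    interlace : ∀ i → κ (suc i) ≤ μ i
    support   : ∀ i → ℓ ≤ i → κ i ≡ 0
    size      : ∀ m → ℓ ≤ m → sum< m κ ≡ a + sum< m μ

  lower-support : ∀ i → ℓ ≤ i → μ i ≡ 0
  lower-support i ℓ≤i = n≤0⇒n≡0 (subst (μ i ≤_) (support i ℓ≤i) (lower i))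

open Step

Step-resp : ∀ {ℓ μ μ′ κ κ′ a a′} → μ ≗ μ′ → κ ≗ κ′ → a ≡ a′ → Step ℓ μ κ a → Step ℓ μ′ κ′ a′
Step-resp μ≗ κ≗ refl s = record
  { lower     = λ i → subst₂ _≤_ (μ≗ i) (κ≗ i) (lower s i)
  ; interlace = λ i → subst₂ _≤_ (κ≗ (suc i)) (μ≗ i) (interlace s i)
  ; support   = λ i ℓ≤i → trans (sym (κ≗ i)) (support s i ℓ≤i)
  ; size      = λ m ℓ≤m → trans (sym (sum<-cong m κ≗)) (trans (size s m ℓ≤m) (cong (_ +_) (sum<-cong m μ≗)))
  }

-- `ℓ` is only an upper bound on the number of rows, so shapes with different numbers of rows can
-- share one bound along a chain.
Step-weaken : ∀ {ℓ ℓ′ μ κ a} → ℓ ≤ ℓ′ → Step ℓ μ κ a → Step ℓ′ μ κ a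
Step-weaken ℓ≤ℓ′ s = record
  { lower     = lower s
  ; interlace = interlace s
  ; support   = λ i ℓ′≤i → support s i (≤-trans ℓ≤ℓ′ ℓ′≤i)
  ; size      = λ m ℓ′≤m → size s m (≤-trans ℓ≤ℓ′ ℓ′≤m)
  }

-- By interlacing, `κ` without its first row fits into `μ`, so the strip cannot be larger than that
-- first row. This is the source of the bound α ≤ κ on exponents.
size≤first : ∀ {ℓ μ κ a} → Step ℓ μ κ a → a ≤ κ 0
size≤first {ℓ} {μ} {κ} {a} s = +-cancelʳ-≤ (sum< ℓ μ) a (κ 0) $ begin
  a + sum< ℓ μ            ≤⟨ +-monoʳ-≤ a (≤-trans (m≤m+n _ (μ ℓ)) (≤-reflexive (sym (sum<-last ℓ μ)))) ⟩
  a + sum< (suc ℓ) μ      ≡⟨ size s (suc ℓ) (n≤1+n ℓ) ⟨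
  κ 0 + sum< ℓ (κ ∘ suc)  ≤⟨ +-monoʳ-≤ (κ 0) (sum<-mono ℓ (interlace s)) ⟩
  κ 0 + sum< ℓ μ          ∎
  where open ≤-Reasoning

Steps : ℕ → ℕ → (ℕ → ℕ) → (ℕ → Row) → Set
Steps ℓ n f g = ∀ {t} → t < n → Step ℓ (g t) (g (suc t)) (f t)

Steps-tail : ∀ {ℓ n f g} → Steps ℓ (suc n) f g → Steps ℓ n (f ∘ suc) (g ∘ suc)
Steps-tail S t<n = S (s<s t<n)

Steps-mono : ∀ {ℓ n f g} → Steps ℓ n f g → ∀ {s t} → s ≤ t → t ≤ n → ∀ i → g s i ≤ g t i
Steps-mono {g = g} S {s} {zero}  z≤n  _   i = ≤-refl
Steps-mono {g = g} S {s} {suc t} s≤1+t t<n i with m≤n⇒m<n∨m≡n s≤1+t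
... | inj₁ (s≤s s≤t) = ≤-trans (Steps-mono S s≤t (<⇒≤ t<n) i) (lower (S t<n) i)
... | inj₂ refl      = ≤-refl

-- A horizontal strip has at most one box in each column, so going back `d` shapes shortens a column
-- by at most `d`. Both the bound on column lengths and the forced rows of length `R` come from
-- this.
Steps-interlace : ∀ {ℓ n f g} → Steps ℓ n f g → ∀ d {s} → d + s ≤ n → ∀ i → g (d + s) (d + i) ≤ g s i
Steps-interlace S zero    _     i = ≤-refl
Steps-interlace S (suc d) d+s<n i = ≤-trans (interlace (S d+s<n) (d + i)) (Steps-interlace S d (<⇒≤ d+s<n) i)

record Chain (n ℓ : ℕ) (μ ν : Row) (f : ℕ → ℕ) (g : ℕ → Row) : Set where
  field
    start : g 0 ≗ μ
    end   : g n ≗ ν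
    steps : Steps ℓ n f g

open Chain

Chain-≤end : ∀ {n ℓ μ ν f g} → Chain n ℓ μ ν f g → ∀ {t} → t ≤ n → ∀ i → g t i ≤ ν i
Chain-≤end c t≤n i = ≤-trans (Steps-mono (steps c) t≤n ≤-refl i) (≤-reflexive (end c i))

Chain-start≤ : ∀ {n ℓ μ ν f g} → Chain n ℓ μ ν f g → ∀ {t} → t ≤ n → ∀ i → μ i ≤ g t i
Chain-start≤ c t≤n i = ≤-trans (≤-reflexive (sym (start c i))) (Steps-mono (steps c) z≤n t≤n i)

infix 4 _≗[_]_

_≗[_]_ : (ℕ → Row) → ℕ → (ℕ → Row) → Set
g ≗[ n ] h = ∀ t → t ≤ n → g t ≗ h t

-- Exchanging the sizes of two consecutive strips.

-- The Bender–Knuth involution: given μ and ν, the rows κ with κ/μ and ν/κ horizontal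
-- strips are those with lo i ≤ κ i ≤ hi i for all i, and lo i + hi (i+1) = μ i + ν (i+1),
-- so reflecting every κ i in its interval exchanges the sizes of the two strips.

module _ (μ ν : Row) where

  lo hi : Row
  lo i       = ν (suc i) ⊔ μ i
  -- Row 0 has no row of `μ` above it, so only `ν` bounds it.
  hi zero    = ν 0
  hi (suc i) = ν (suc i) ⊓ μ i

  hi≤ν : ∀ i → hi i ≤ ν i
  hi≤ν zero    = ≤-refl
  hi≤ν (suc i) = m⊓n≤m (ν (suc i)) (μ i)

  reflect : Row → Row
  reflect κ i = lo i + hi i ∸ κ i

  -- The pairing is off by one row: `lo i` goes with `hi (suc i)`, the maximum and the minimum of
  -- the same two numbers, and `hi 0` is the unpaired `ν 0`. The two vanishing hypotheses let the
  -- sums run one row further at no cost.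
  sum-lo+hi : ∀ m → hi m ≡ 0 → ν m ≡ 0 → sum< m lo + sum< m hi ≡ sum< m ν + sum< m μ
  sum-lo+hi m hi≡0 ν≡0 = begin
    sum< m lo + sum< m hi                                        ≡⟨ cong (sum< m lo +_) (drop-last hi hi≡0) ⟨
    sum< m lo + (ν 0 + sum< m (hi ∘ suc))                        ≡⟨ solve 3 (λ a b c → a :+ (b :+ c) := b :+ (a :+ c)) refl (sum< m lo) (ν 0) _ ⟩
    ν 0 + (sum< m lo + sum< m (hi ∘ suc))                        ≡⟨ cong (ν 0 +_) (sum<-+ m lo (hi ∘ suc)) ⟨
    ν 0 + sum< m (λ i → lo i + hi (suc i))                       ≡⟨ cong (ν 0 +_) (sum<-cong m λ i → m⊔n+m⊓n (ν (suc i)) (μ i)) ⟩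
    ν 0 + sum< m (λ i → ν (suc i) + μ i)                         ≡⟨ cong (ν 0 +_) (sum<-+ m (ν ∘ suc) μ) ⟩
    ν 0 + (sum< m (ν ∘ suc) + sum< m μ)                          ≡⟨ +-assoc (ν 0) _ _ ⟨
    ν 0 + sum< m (ν ∘ suc) + sum< m μ                            ≡⟨ cong (_+ sum< m μ) (drop-last ν ν≡0) ⟩
    sum< m ν + sum< m μ                                          ∎
    where
    open ≡-Reasoning
    open +-*-Solver
    drop-last : ∀ f → f m ≡ 0 → sum< (suc m) f ≡ sum< m f
    drop-last f f≡0 = trans (sum<-last m f) (trans (cong (sum< m f +_) f≡0) (+-identityʳ _))
    m⊔n+m⊓n : ∀ m n → (m ⊔ n) + (m ⊓ n) ≡ m + n
    m⊔n+m⊓n m n with ≤-total m n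
    ... | inj₁ m≤n = trans (cong₂ _+_ (m≤n⇒m⊔n≡n m≤n) (m≤n⇒m⊓n≡m m≤n)) (+-comm n m)
    ... | inj₂ n≤m = cong₂ _+_ (m≥n⇒m⊔n≡m n≤m) (m≥n⇒m⊓n≡n n≤m)

module _ {ℓ μ κ ν a b} (s : Step ℓ μ κ a) (r : Step ℓ κ ν b) where

  private
    κ′ : Row
    κ′ = reflect μ ν κ

    lo≤κ : ∀ i → lo μ ν i ≤ κ i
    lo≤κ i = ⊔-lub (interlace r i) (lower s i)

    κ≤hi : ∀ i → κ i ≤ hi μ ν i
    κ≤hi zero    = lower r 0
    κ≤hi (suc i) = ⊓-glb (lower r (suc i)) (interlace s i)

    lo≤κ′ : ∀ i → lo μ ν i ≤ κ′ i
    lo≤κ′ i = m+n≤o⇒m≤o∸n (lo μ ν i) (+-monoʳ-≤ (lo μ ν i) (κ≤hi i))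

    κ′≤hi : ∀ i → κ′ i ≤ hi μ ν i
    κ′≤hi i = m≤n+o⇒m∸n≤o _ (κ i) (+-monoˡ-≤ (hi μ ν i) (lo≤κ i))

    κ′≤ν : ∀ i → κ′ i ≤ ν i
    κ′≤ν i = ≤-trans (κ′≤hi i) (hi≤ν μ ν i)

    -- `κ′ i + κ i` is `lo i + hi i` in every row, so `κ` and `κ′` together have the size of `μ` and
    -- `ν` together; the gain of `κ′` over `μ` is then the gain of `ν` over `κ`.
    κ′-size : ∀ m → ℓ ≤ m → sum< m κ′ ≡ b + sum< m μ
    κ′-size m ℓ≤m = +-cancelʳ-≡ (sum< m κ) _ _ $ begin
      sum< m κ′ + sum< m κ                   ≡⟨ sum<-+ m κ′ κ ⟨
      sum< m (λ i → κ′ i + κ i)              ≡⟨ sum<-cong m (λ i → m∸n+n≡m (≤-trans (κ≤hi i) (m≤n+m _ (lo μ ν i)))) ⟩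
      sum< m (λ i → lo μ ν i + hi μ ν i)     ≡⟨ sum<-+ m (lo μ ν) (hi μ ν) ⟩
      sum< m (lo μ ν) + sum< m (hi μ ν)      ≡⟨ sum-lo+hi μ ν m (n≤0⇒n≡0 (subst (hi μ ν m ≤_) ν≡0 (hi≤ν μ ν m))) ν≡0 ⟩
      sum< m ν + sum< m μ                    ≡⟨ cong (_+ sum< m μ) (size r m ℓ≤m) ⟩
      b + sum< m κ + sum< m μ                ≡⟨ solve 3 (λ b k u → b :+ k :+ u := b :+ u :+ k) refl b (sum< m κ) (sum< m μ) ⟩
      b + sum< m μ + sum< m κ                ∎
      where
      open ≡-Reasoning
      open +-*-Solver
      ν≡0 = support r m ℓ≤m

  reflect-stepˡ : Step ℓ μ κ′ b
  reflect-stepˡ = record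
    { lower     = λ i → ≤-trans (m≤n⊔m (ν (suc i)) (μ i)) (lo≤κ′ i)
    ; interlace = λ i → ≤-trans (κ′≤hi (suc i)) (m⊓n≤n (ν (suc i)) (μ i))
    ; support   = λ i ℓ≤i → n≤0⇒n≡0 (subst (κ′ i ≤_) (support r i ℓ≤i) (κ′≤ν i))
    ; size      = κ′-size
    }

  reflect-stepʳ : Step ℓ κ′ ν a
  reflect-stepʳ = record
    { lower     = κ′≤ν
    ; interlace = λ i → ≤-trans (m≤m⊔n (ν (suc i)) (μ i)) (lo≤κ′ i)
    ; support   = support r
    ; size      = λ m ℓ≤m → begin
        sum< m ν                ≡⟨ size r m ℓ≤m ⟩
        b + sum< m κ            ≡⟨ cong (b +_) (size s m ℓ≤m) ⟩
        b + (a + sum< m μ)      ≡⟨ solve 3 (λ b a u → b :+ (a :+ u) := a :+ (b :+ u)) refl b a (sum< m μ) ⟩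
        a + (b + sum< m μ)      ≡⟨ cong (a +_) (κ′-size m ℓ≤m) ⟨
        a + sum< m κ′           ∎
    }
    where open ≡-Reasoning
          open +-*-Solver

  reflect-≤ : ∀ i → κ i ≤ lo μ ν i + hi μ ν i
  reflect-≤ i = ≤-trans (κ≤hi i) (m≤n+m _ (lo μ ν i))

-- The outer shapes determine the interval of each row, and by `reflect-≤` the subtraction from
-- `lo i + hi i` does not truncate, so it cancels.
reflect-injective : ∀ {ℓ μ κ ν a b μ′ κ′ ν′ a′ b′} →
  Step ℓ μ κ a → Step ℓ κ ν b → Step ℓ μ′ κ′ a′ → Step ℓ κ′ ν′ b′ →
  μ ≗ μ′ → ν ≗ ν′ → reflect μ ν κ ≗ reflect μ′ ν′ κ′ → κ ≗ κ′
reflect-injective {μ = μ} {κ} {ν} {μ′ = μ′} {κ′} {ν′} s r s′ r′ μ≗ ν≗ eq i =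
  ∸-cancelˡ-≡ (reflect-≤ s r i) (subst (κ′ i ≤_) (sym lo+hi≡) (reflect-≤ s′ r′ i))
    (trans (eq i) (cong (_∸ κ′ i) (sym lo+hi≡)))
  where
  hi≡ : ∀ i → hi μ ν i ≡ hi μ′ ν′ i
  hi≡ zero    = ν≗ 0
  hi≡ (suc i) = cong₂ _⊓_ (ν≗ (suc i)) (μ≗ i)
  lo+hi≡ : lo μ ν i + hi μ ν i ≡ lo μ′ ν′ i + hi μ′ ν′ i
  lo+hi≡ = cong₂ _+_ (cong₂ _⊔_ (ν≗ (suc i)) (μ≗ i)) (hi≡ i)

-- Permuting the strip sizes of a chain.

-- The derivation of `α ↭ β` serves as a word in adjacent transpositions: `swap` reflects the shape
-- between the two exchanged strips. A tail keeps its first shape (`permute-start`), so the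
-- separately treated pieces still fit together.
permute : ∀ {α β : List ℕ} → α ↭ β → (ℕ → Row) → ℕ → Row
permute ↭.refl         g               = g
permute (↭.prep _ p)   g zero          = g 0
permute (↭.prep _ p)   g (suc t)       = permute p (g ∘ suc) t
permute (↭.swap _ _ p) g zero          = g 0
permute (↭.swap _ _ p) g (suc zero)    = reflect (g 0) (g 2) (g 1)
permute (↭.swap _ _ p) g (suc (suc t)) = permute p (g ∘ suc ∘ suc) t
permute (↭.trans p q)  g               = permute q (permute p g)

permute-start : ∀ {α β} (p : α ↭ β) g → permute p g 0 ≗ g 0
permute-start ↭.refl         g i = refl
permute-start (↭.prep _ p)   g i = refl
permute-start (↭.swap _ _ p) g i = refl
permute-start (↭.trans p q)  g i = trans (permute-start q (permute p g) i) (permute-start p g i)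

permute-end : ∀ {α β} (p : α ↭ β) g → permute p g (length α) ≗ g (length α)
permute-end ↭.refl         g i = refl
permute-end (↭.prep _ p)   g i = permute-end p (g ∘ suc) i
permute-end (↭.swap _ _ p) g i = permute-end p (g ∘ suc ∘ suc) i
permute-end (↭.trans p q)  g i = trans
  (subst (λ n → permute q (permute p g) n i ≡ permute p g n i) (sym (↭-length p)) (permute-end q (permute p g) i))
  (permute-end p g i)

permute-steps : ∀ {ℓ α β} (p : α ↭ β) {g} →
  Steps ℓ (length α) (nth α) g → Steps ℓ (length β) (nth β) (permute p g)
permute-steps ↭.refl         S = S
permute-steps (↭.prep _ p)   {g} S {zero}  _         =
  Step-resp (λ _ → refl) (sym ∘ permute-start p (g ∘ suc)) refl (S z<s)
permute-steps (↭.prep _ p)   {g} S {suc t} (s<s t<n) = permute-steps p {g ∘ suc} (Steps-tail {g = g} S) t<n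
permute-steps (↭.swap _ _ p) {g} S {zero}        _ = reflect-stepˡ (S z<s) (S (s<s z<s))
permute-steps (↭.swap _ _ p) {g} S {suc zero}    _ =
  Step-resp (λ _ → refl) (sym ∘ permute-start p (g ∘ suc ∘ suc)) refl (reflect-stepʳ (S z<s) (S (s<s z<s)))
permute-steps (↭.swap _ _ p) {g} S {suc (suc t)} (s<s (s<s t<n)) =
  permute-steps p {g ∘ suc ∘ suc} (λ t<n → S (s<s (s<s t<n))) t<n
permute-steps (↭.trans p q)  {g} S t<n = permute-steps q {permute p g} (permute-steps p {g} S) t<n

permute-injective : ∀ {ℓ α β} (p : α ↭ β) {g h} →
  Steps ℓ (length α) (nth α) g → Steps ℓ (length α) (nth α) h →
  permute p g ≗[ length α ] permute p h → g ≗[ length α ] h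
permute-injective ↭.refl         S T eq = eq
permute-injective (↭.prep _ p)   S T eq zero    _         = eq 0 z≤n
permute-injective (↭.prep _ p)   {g} {h} S T eq (suc t) (s≤s t≤n) =
  permute-injective p (Steps-tail {g = g} S) (Steps-tail {g = h} T) (λ t → eq (suc t) ∘ s≤s) t t≤n
permute-injective {ℓ} {_ ∷ _ ∷ α} (↭.swap _ _ p) {g} {h} S T eq = go
  where
  -- The tail is recovered first, because the reflection of shape 1 depends on shape 2, where the
  -- tail begins.
  tail-eq : (g ∘ suc ∘ suc) ≗[ length α ] (h ∘ suc ∘ suc)
  tail-eq = permute-injective p (λ t<n → S (s<s (s<s t<n))) (λ t<n → T (s<s (s<s t<n)))
              (λ t t≤n → eq (suc (suc t)) (s≤s (s≤s t≤n)))
  go : g ≗[ suc (suc (length α)) ] h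
  go zero          _               = eq 0 z≤n
  go (suc zero)    _               = reflect-injective (S z<s) (S (s<s z<s)) (T z<s) (T (s<s z<s))
                                       (eq 0 z≤n) (tail-eq 0 z≤n) (eq 1 (s≤s z≤n))
  go (suc (suc t)) (s≤s (s≤s t≤n)) = tail-eq t t≤n
permute-injective (↭.trans p q) {g} {h} S T eq =
  permute-injective p S T
    (subst (permute p g ≗[_] permute p h) (sym (↭-length p))
      (permute-injective q {permute p g} {permute p h} (permute-steps p S) (permute-steps p T)
        (subst (permute q (permute p g) ≗[_] permute q (permute p h)) (↭-length p) eq)))

module _ (n : ℕ) (f : ℕ → ℕ) where

  private
    α β : List ℕ
    α = applyUpTo f n
    β = applyDownFrom f n

    -- Supplies the sequence of adjacent swaps. Any derivation would do, since only the resulting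
    -- content and injectivity are used.
    α↭β : α ↭ β
    α↭β = subst (α ↭_) (reverse-applyUpTo f n) (↭-sym (↭-reverse α))

    |α| : length α ≡ n
    |α| = length-applyUpTo f n

    |β| : length β ≡ n
    |β| = trans (sym (↭-length α↭β)) |α|

    nth-applyUpTo : ∀ f n {t} → t < n → nth (applyUpTo f n) t ≡ f t
    nth-applyUpTo f (suc n) {zero}  _         = refl
    nth-applyUpTo f (suc n) {suc t} (s<s t<n) = nth-applyUpTo (f ∘ suc) n t<n

    nth-applyDownFrom : ∀ n {t} → t < n → nth (applyDownFrom f n) t ≡ f (n ∸ suc t)
    nth-applyDownFrom (suc n) {zero}  _         = refl
    nth-applyDownFrom (suc n) {suc t} (s<s t<n) = nth-applyDownFrom n t<n

    listSteps : ∀ {ℓ g} → Steps ℓ n f g → Steps ℓ (length α) (nth α) g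
    listSteps S t<|α| = Step-resp (λ _ → refl) (λ _ → refl) (sym (nth-applyUpTo f n t<n)) (S t<n)
      where t<n = subst (_ <_) |α| t<|α|

  reversal : (ℕ → Row) → ℕ → Row
  reversal = permute α↭β

  reversal-chain : ∀ {ℓ μ ν g} → Chain n ℓ μ ν f g → Chain n ℓ μ ν (λ t → f (n ∸ suc t)) (reversal g)
  reversal-chain {g = g} c = record
    { start = λ i → trans (permute-start α↭β g i) (start c i)
    ; end   = λ i → trans (subst (λ k → reversal g k i ≡ g k i) |α| (permute-end α↭β g i)) (end c i)
    ; steps = λ t<n → Step-resp (λ _ → refl) (λ _ → refl) (nth-applyDownFrom n t<n)
                (permute-steps α↭β {g} (listSteps {g = g} (steps c)) (subst (_ <_) (sym |β|) t<n))
    }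

  reversal-injective : ∀ {ℓ μ ν g h} → Chain n ℓ μ ν f g → Chain n ℓ μ ν f h →
    reversal g ≗[ n ] reversal h → g ≗[ n ] h
  reversal-injective {g = g} {h} c d eq =
    subst (g ≗[_] h) |α| (permute-injective α↭β {g} {h} (listSteps {g = g} (steps c)) (listSteps {g = h} (steps d))
      (subst (reversal g ≗[_] reversal h) (sym |α|) eq))

-- The rectangular complement of a chain.

-- Containment and interlacing trade places: `κ (suc i) ≤ μ i` says that `κ` fits into `R ◂ μ`, and
-- `μ i ≤ κ i` says that the new pair interlaces. `R ∸ a` does not truncate because `a ≤ κ 0 ≤ R`.
complement-step : ∀ {ℓ μ κ a R} → κ 0 ≤ R → Step ℓ μ κ a → Step (suc ℓ) κ (R ◂ μ) (R ∸ a)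
complement-step {ℓ} {μ} {κ} {a} {R} κ₀≤R s = record
  { lower     = λ { zero → κ₀≤R ; (suc i) → interlace s i }
  ; interlace = lower s
  ; support   = λ { (suc i) (s≤s ℓ≤i) → lower-support s i ℓ≤i }
  ; size      = λ { (suc m) (s≤s ℓ≤m) → begin
      R + sum< m μ                           ≡⟨ cong (_+ sum< m μ) (m∸n+n≡m (≤-trans (size≤first s) κ₀≤R)) ⟨
      R ∸ a + a + sum< m μ                   ≡⟨ +-assoc (R ∸ a) a _ ⟩
      R ∸ a + (a + sum< m μ)                 ≡⟨ cong (λ k → R ∸ a + (a + k)) (+-identityʳ _) ⟨
      R ∸ a + (a + (sum< m μ + 0))           ≡⟨ cong (λ k → R ∸ a + (a + (sum< m μ + k))) (lower-support s m ℓ≤m) ⟨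
      R ∸ a + (a + (sum< m μ + μ m))         ≡⟨ cong (λ k → R ∸ a + (a + k)) (sum<-last m μ) ⟨
      R ∸ a + (a + sum< (suc m) μ)           ≡⟨ cong (R ∸ a +_) (size s (suc m) (m≤n⇒m≤1+n ℓ≤m)) ⟨
      R ∸ a + sum< (suc m) κ                 ∎ }
  }
  where open ≡-Reasoning

◂-step : ∀ {ℓ μ κ a R} → κ 0 ≤ R → Step ℓ μ κ a → Step (suc ℓ) (R ◂ μ) (R ◂ κ) a
◂-step {ℓ} {μ} {κ} {a} {R} κ₀≤R s = record
  { lower     = λ { zero → ≤-refl ; (suc i) → lower s i }
  ; interlace = λ { zero → κ₀≤R ; (suc i) → interlace s i }
  ; support   = λ { (suc i) (s≤s ℓ≤i) → support s i ℓ≤i }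
  ; size      = λ { (suc m) (s≤s ℓ≤m) → trans (cong (R +_) (size s m ℓ≤m)) (x+[a+y] R a (sum< m μ)) }
  }
  where
  open +-*-Solver
  x+[a+y] = solve 3 (λ x a y → x :+ (a :+ y) := a :+ (x :+ y)) refl

nth-replicate-< : ∀ n {R} xs {i} → i < n → nth (List.replicate n R ++ xs) i ≡ R
nth-replicate-< (suc n) xs {zero}  _         = refl
nth-replicate-< (suc n) xs {suc i} (s<s i<n) = nth-replicate-< n xs i<n

nth-replicate-+ : ∀ n {R} xs i → nth (List.replicate n R ++ xs) (n + i) ≡ nth xs i
nth-replicate-+ zero    xs i = refl
nth-replicate-+ (suc n) xs i = nth-replicate-+ n xs i

module _ (R : ℕ) where

  -- The t-th shape is (Rᵗ, g (n - t)).
  complementᶜ : ℕ → (ℕ → Row) → ℕ → Row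
  complementᶜ n g zero    = g n
  complementᶜ n g (suc t) = R ◂ complementᶜ (pred n) g t

  -- Step 0 complements the last strip of `g`; each later step is a step for the chain without that
  -- strip, with a row `R` put on top. The number of rows grows along the way, hence the common
  -- bound `n + ℓ`.
  complementᶜ-steps : ∀ n {ℓ f g} → Steps ℓ n f g → (∀ {t} → t ≤ n → g t 0 ≤ R) →
    Steps (n + ℓ) n (λ t → R ∸ f (n ∸ suc t)) (complementᶜ n g)
  complementᶜ-steps (suc n) {ℓ} S g≤R {zero} _ =
    Step-weaken (s≤s (m≤n+m ℓ n)) (complement-step (g≤R ≤-refl) (S ≤-refl))
  complementᶜ-steps (suc n) {g = g} S g≤R {suc t} (s<s t<n) =
    ◂-step ≤-refl (complementᶜ-steps n {g = g} (λ t<n → S (m<n⇒m<1+n t<n)) (λ t≤n → g≤R (m≤n⇒m≤1+n t≤n)) t<n)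

  complementᶜ-end : ∀ n {g xs} → g 0 ≗ nth xs → complementᶜ n g n ≗ nth (List.replicate n R ++ xs)
  complementᶜ-end zero    g≗ i       = g≗ i
  complementᶜ-end (suc n) g≗ zero    = refl
  complementᶜ-end (suc n) g≗ (suc i) = complementᶜ-end n g≗ i

  complementᶜ-shift : ∀ n g t i → complementᶜ n g t (t + i) ≡ g (n ∸ t) i
  complementᶜ-shift n       g zero    i = refl
  complementᶜ-shift zero    g (suc t) i = trans (complementᶜ-shift zero g t i) (cong (λ k → g k i) (0∸n≡0 t))
  complementᶜ-shift (suc n) g (suc t) i = complementᶜ-shift n g t i

  complementᶜ-injective : ∀ n {g h} → complementᶜ n g ≗[ n ] complementᶜ n h → g ≗[ n ] h
  complementᶜ-injective n {g} {h} eq t t≤n i = begin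
    g t i                                  ≡⟨ cong (λ k → g k i) (m∸[m∸n]≡n t≤n) ⟨
    g (n ∸ (n ∸ t)) i                      ≡⟨ complementᶜ-shift n g (n ∸ t) i ⟨
    complementᶜ n g (n ∸ t) (n ∸ t + i)    ≡⟨ eq (n ∸ t) (m∸n≤m n t) (n ∸ t + i) ⟩
    complementᶜ n h (n ∸ t) (n ∸ t + i)    ≡⟨ complementᶜ-shift n h (n ∸ t) i ⟩
    h (n ∸ (n ∸ t)) i                      ≡⟨ cong (λ k → h k i) (m∸[m∸n]≡n t≤n) ⟩
    h t i                                  ∎
    where open ≡-Reasoning

  complementᶜ-chain : ∀ {n ℓ ν f g} xs → ν 0 ≤ R → Chain n ℓ (nth xs) ν f g →
    Chain n (n + ℓ) ν (nth (List.replicate n R ++ xs)) (λ t → R ∸ f (n ∸ suc t)) (complementᶜ n g)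
  complementᶜ-chain {n} {g = g} xs ν₀≤R c = record
    { start = end c
    ; end   = complementᶜ-end n (start c)
    ; steps = complementᶜ-steps n {g = g} (steps c) (λ t≤n → ≤-trans (Chain-≤end c t≤n 0) ν₀≤R)
    }

-- Recovering a chain from one that ends in (Rⁿ, xs).

module _ {n ℓ R ν xs f h} (c : Chain n ℓ ν (nth (List.replicate n R ++ xs)) f h) where

  -- The upper bound is containment in the last shape. For the lower one, only `n ∸ s` strips
  -- remain, each adding at most one box per column, so row `i` of `h s` is at least row
  -- `(n ∸ s) + i` of the last shape, which is among its first `n`.
  chain-full : ∀ {s i} → s ≤ n → i < s → h s i ≡ R
  chain-full {s} {i} s≤n i<s = ≤-antisym
    (≤-trans (Chain-≤end c s≤n i) (≤-reflexive (nth-replicate-< n xs (<-≤-trans i<s s≤n))))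
    (begin
      R                                      ≡⟨ nth-replicate-< n xs d+i<n ⟨
      nth (List.replicate n R ++ xs) (d + i)      ≡⟨ end c (d + i) ⟨
      h n (d + i)                            ≡⟨ cong (λ k → h k (d + i)) d+s≡n ⟨
      h (d + s) (d + i)                      ≤⟨ Steps-interlace (steps c) d (≤-reflexive d+s≡n) i ⟩
      h s i                                  ∎)
    where
    open ≤-Reasoning
    d = n ∸ s
    d+s≡n : d + s ≡ n
    d+s≡n = m∸n+n≡m s≤n
    d+i<n : d + i < n
    d+i<n = subst (d + i <_) d+s≡n (+-monoʳ-< d i<s)

-- The column offset `n ∸ t` discards the rows that `chain-full` forces to have length `R`.
uncomplement : ℕ → (ℕ → Row) → ℕ → Row
uncomplement n h t i = h (n ∸ t) (n ∸ t + i)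

-- Again containment and interlacing trade places. `σ` loses one more row of length `R` than `κ`,
-- and this single row turns the size `a` into `R ∸ a`.
uncomplement-step : ∀ {ℓ s R a} {κ σ : Row} → (∀ i → i < s → κ i ≡ R) → (∀ i → i < suc s → σ i ≡ R) →
  Step ℓ κ σ a → Step ℓ (λ i → σ (suc s + i)) (λ i → κ (s + i)) (R ∸ a)
uncomplement-step {ℓ} {s} {R} {a} {κ} {σ} κ≡R σ≡R st = record
  { lower     = λ i → interlace st (s + i)
  ; interlace = λ i → subst (λ k → κ k ≤ σ (suc s + i)) (sym (+-suc s i)) (lower st (suc s + i))
  ; support   = λ i ℓ≤i → lower-support st (s + i) (m≤n⇒m≤o+n s ℓ≤i)
  ; size      = λ m ℓ≤m → let open ≡-Reasoning in +-cancelˡ-≡ a _ _ $ begin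
      a + Σκ m                      ≡⟨ size-R m ℓ≤m ⟨
      R + Σσ m                      ≡⟨ cong (_+ Σσ m) (m+[n∸m]≡n a≤R) ⟨
      a + (R ∸ a) + Σσ m            ≡⟨ +-assoc a _ _ ⟩
      a + (R ∸ a + Σσ m)            ∎
  }
  where
  open +-*-Solver
  Σκ Σσ : ℕ → ℕ
  Σκ m = sum< m (λ i → κ (s + i))
  Σσ m = sum< m (λ i → σ (suc s + i))
  a≤R : a ≤ R
  a≤R = subst (a ≤_) (σ≡R 0 z<s) (size≤first st)
  size-R : ∀ m → ℓ ≤ m → R + Σσ m ≡ a + Σκ m
  size-R m ℓ≤m = +-cancelˡ-≡ (s * R) _ _ $ begin
    s * R + (R + Σσ m)                       ≡⟨ solve 3 (λ x r y → x :+ (r :+ y) := r :+ x :+ y) refl (s * R) R (Σσ m) ⟩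
    suc s * R + Σσ m                         ≡⟨ cong (_+ Σσ m) (sum<-const (suc s) σ≡R) ⟨
    sum< (suc s) σ + Σσ m                    ≡⟨ sum<-split (suc s) m σ ⟨
    sum< (suc s + m) σ                       ≡⟨ size st (suc s + m) (m≤n⇒m≤o+n (suc s) ℓ≤m) ⟩
    -- `σ` is cut by one row more than `κ`; the surplus row of `κ` lies beyond its support and is
    -- empty.
    a + sum< (suc s + m) κ                   ≡⟨ cong (a +_) (sum<-last (s + m) κ) ⟩
    a + (sum< (s + m) κ + κ (s + m))         ≡⟨ cong (λ k → a + (sum< (s + m) κ + k)) (lower-support st (s + m) (m≤n⇒m≤o+n s ℓ≤m)) ⟩
    a + (sum< (s + m) κ + 0)                 ≡⟨ cong (a +_) (+-identityʳ _) ⟩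
    a + sum< (s + m) κ                       ≡⟨ cong (a +_) (sum<-split s m κ) ⟩
    a + (sum< s κ + Σκ m)                    ≡⟨ cong (λ k → a + (k + Σκ m)) (sum<-const s κ≡R) ⟩
    a + (s * R + Σκ m)                       ≡⟨ solve 3 (λ x a y → a :+ (x :+ y) := x :+ (a :+ y)) refl (s * R) a (Σκ m) ⟩
    s * R + (a + Σκ m)                       ∎
    where open ≡-Reasoning

module _ {n ℓ R : ℕ} {ν : Row} {f : ℕ → ℕ} (xs : List ℕ) where

  private
    Target : (ℕ → Row) → Set
    Target = Chain n ℓ ν (nth (List.replicate n R ++ xs)) f

  uncomplement-chain : ∀ {h} → Target h → Chain n ℓ (nth xs) ν (λ t → R ∸ f (n ∸ suc t)) (uncomplement n h)
  uncomplement-chain {h} c = record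
    { start = λ i → trans (end c (n + i)) (nth-replicate-+ n xs i)
    ; end   = λ i → trans (cong (λ k → h k (k + i)) (n∸n≡0 n)) (start c i)
    ; steps = λ {t} t<n → let s = n ∸ suc t
                              s<n = ∸-monoʳ-< {n} z<s t<n
                              1+s≡n∸t = sym (+-∸-assoc 1 t<n)
                          in Step-resp (λ i → cong (λ k → h k (k + i)) 1+s≡n∸t) (λ _ → refl) refl
                               (uncomplement-step {s = s} (λ i → chain-full c (<⇒≤ s<n)) (λ i → chain-full c s<n) (steps c s<n))
    }

  -- The discarded rows equal `R` in both chains, so agreement of the remaining rows suffices.
  uncomplement-injective : ∀ {h h′} → Target h → Target h′ →
    uncomplement n h ≗[ n ] uncomplement n h′ → h ≗[ n ] h′
  uncomplement-injective {h} {h′} c c′ eq s s≤n i with i <? s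
  ... | yes i<s = trans (chain-full c s≤n i<s) (sym (chain-full c′ s≤n i<s))
  ... | no  i≮s = begin
    h s i                                      ≡⟨ cong (h s) s+[i∸s] ⟨
    h s (s + (i ∸ s))                          ≡⟨ cong (λ k → h k (k + (i ∸ s))) (m∸[m∸n]≡n s≤n) ⟨
    uncomplement n h (n ∸ s) (i ∸ s)           ≡⟨ eq (n ∸ s) (m∸n≤m n s) (i ∸ s) ⟩
    uncomplement n h′ (n ∸ s) (i ∸ s)          ≡⟨ cong (λ k → h′ k (k + (i ∸ s))) (m∸[m∸n]≡n s≤n) ⟩
    h′ s (s + (i ∸ s))                         ≡⟨ cong (h′ s) s+[i∸s] ⟩
    h′ s i                                     ∎
    where
    open ≡-Reasoning
    s+[i∸s] = m+[n∸m]≡n (≮⇒≥ i≮s)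

-- Decreasing rows, and counting in lists.

parts-support : ∀ xs i → length xs ≤ i → nth xs i ≡ 0
parts-support []       i       _         = refl
parts-support (x ∷ xs) (suc i) (s≤s |xs|≤i) = parts-support xs i |xs|≤i

nth-decreasing : ∀ {xs} → Linked _≥_ xs → ∀ i → nth xs (suc i) ≤ nth xs i
nth-decreasing []           i       = ≤-refl
nth-decreasing [-]          i       = z≤n
nth-decreasing (x≥y ∷ _)    zero    = x≥y
nth-decreasing (_ ∷ ys)     (suc i) = nth-decreasing ys i

antitone : ∀ {f : Row} → (∀ i → f (suc i) ≤ f i) → ∀ {i j} → i ≤ j → f j ≤ f i
antitone f↓ {i} {zero}  z≤n = ≤-refl
antitone f↓ {i} {suc j} i≤1+j with m≤n⇒m<n∨m≡n i≤1+j
... | inj₁ (s≤s i≤j) = ≤-trans (f↓ j) (antitone f↓ i≤j)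
... | inj₂ refl      = ≤-refl

lookup-injective : ∀ {A : Set} {xs : List A} → Unique xs → ∀ a b →
  List.lookup xs a ≡ List.lookup xs b → a ≡ b
lookup-injective (_ ∷ _)    Fin.zero    Fin.zero    _  = refl
lookup-injective (x∉ ∷ _)   Fin.zero    (Fin.suc b) eq = contradiction eq (All.lookup x∉ (∈-lookup b))
lookup-injective (x∉ ∷ _)   (Fin.suc a) Fin.zero    eq = contradiction (sym eq) (All.lookup x∉ (∈-lookup a))
lookup-injective (_ ∷ uniq) (Fin.suc a) (Fin.suc b) eq = cong Fin.suc (lookup-injective uniq a b eq)

count≡length-filter : ∀ {A B : Set} {P : Pred B 0ℓ} {Q : Pred A 0ℓ} (P? : Decidable P) (Q? : Decidable Q)
  (xs : List A) (v : Vec B (length xs)) →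
  (∀ a → (P (Vec.lookup v a) → Q (List.lookup xs a)) × (Q (List.lookup xs a) → P (Vec.lookup v a))) →
  Vec.count P? v ≡ length (filter Q? xs)
count≡length-filter P? Q? []       []      P⇔Q = refl
count≡length-filter P? Q? (x ∷ xs) (y ∷ v) P⇔Q
  with ih ← count≡length-filter P? Q? xs v (P⇔Q ∘ Fin.suc) | P? y | Q? x
... | yes _  | yes _  = cong suc ih
... | no _   | no _   = ih
... | yes py | no ¬qx = contradiction (proj₁ (P⇔Q Fin.zero) py) ¬qx
... | no ¬py | yes qx = contradiction (proj₂ (P⇔Q Fin.zero) qx) ¬py

count-⊎ : ∀ {A : Set} {P Q R : Pred A 0ℓ} (P? : Decidable P) (Q? : Decidable Q) (R? : Decidable R) →
  (∀ x → P x → Q x ⊎ R x) → (∀ x → Q x → P x) → (∀ x → R x → P x) → (∀ x → Q x → ¬ R x) →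
  ∀ {m} (v : Vec A m) → Vec.count P? v ≡ Vec.count Q? v + Vec.count R? v
count-⊎ P? Q? R? split Q⇒P R⇒P disjoint = go
  where
  go : ∀ {m} (v : Vec _ m) → Vec.count P? v ≡ Vec.count Q? v + Vec.count R? v
  go []      = refl
  go (x ∷ v) with ih ← go v | P? x | Q? x | R? x
  ... | yes _  | yes _  | no _   = cong suc ih
  ... | yes _  | no _   | yes _  = trans (cong suc ih) (sym (+-suc _ _))
  ... | no _   | no _   | no _   = ih
  ... | _      | yes qx | yes rx = contradiction rx (disjoint x qx)
  ... | no ¬px | yes qx | _      = contradiction (Q⇒P x qx) ¬px
  ... | no ¬px | _      | yes rx = contradiction (R⇒P x rx) ¬px
  ... | yes px | no ¬qx | no ¬rx with split x px
  ...   | inj₁ qx = contradiction qx ¬qx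
  ...   | inj₂ rx = contradiction rx ¬rx

count-<-suc : ∀ {n m} (i : Fin n) (v : Vec (Fin n) m) →
  Vec.count (λ x → toℕ x <? suc (toℕ i)) v ≡ Vec.count (Finₚ._≟ i) v + Vec.count (λ x → toℕ x <? toℕ i) v
count-<-suc i = count-⊎ _ _ _ split
  (λ _ x≡i → subst (λ x → toℕ x < suc (toℕ i)) (sym x≡i) ≤-refl)
  (λ _ → m<n⇒m<1+n)
  (λ _ x≡i x<i → <-irrefl (cong toℕ x≡i) x<i)
  where
  split : ∀ x → toℕ x < suc (toℕ i) → x ≡ i ⊎ toℕ x < toℕ i
  split x (s≤s x≤i) with m≤n⇒m<n∨m≡n x≤i
  ... | inj₁ x<i = inj₂ x<i
  ... | inj₂ x≡i = inj₁ (Finₚ.toℕ-injective x≡i)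

-- Counts the boxes of one row left of column `y`, where `x` is the first column of the row; a
-- variable `x` lets the induction remove boxes from the left.
length-filter-interval : ∀ {A : Set} {Q : Pred A 0ℓ} (Q? : Decidable Q) (h : ℕ → A) x y d → y ≤ x + d →
  (∀ k → Q (h k) → x + k < y) → (∀ k → x + k < y → Q (h k)) →
  length (filter Q? (applyUpTo h d)) ≡ y ∸ x
length-filter-interval Q? h x y zero    y≤x+d _  _  = sym (m≤n⇒m∸n≡0 (subst (y ≤_) (+-identityʳ x) y≤x+d))
length-filter-interval Q? h x y (suc d) y≤x+d Q⇒ ⇒Q
  with Q? (h 0) | length-filter-interval Q? (h ∘ suc) (suc x) y d (subst (y ≤_) (+-suc x d) y≤x+d)
                    (λ k q → subst (_< y) (+-suc x k) (Q⇒ (suc k) q))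
                    (λ k l → ⇒Q (suc k) (subst (_< y) (sym (+-suc x k)) l))
... | yes q | ih = trans (cong suc ih) (sym (+-∸-assoc 1 (subst (_< y) (+-identityʳ x) (Q⇒ 0 q))))
... | no ¬q | ih = trans ih (trans (m≤n⇒m∸n≡0 (m≤n⇒m≤1+n y≤x)) (sym (m≤n⇒m∸n≡0 y≤x)))
  where y≤x = ≮⇒≥ λ x<y → ¬q (⇒Q 0 (subst (_< y) (sym (+-identityʳ x)) x<y))

nth-toList-tabulate : ∀ {n} (h : Fin n → ℕ) i → nth (toList (Vec.tabulate h)) (toℕ i) ≡ h i
nth-toList-tabulate h Fin.zero    = refl
nth-toList-tabulate h (Fin.suc i) = nth-toList-tabulate (h ∘ Fin.suc) i

-- A discrete intermediate value: if `u t` is the length of a fixed row in the `t`-th shape, the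
-- crossing index is the entry of the box in column `j`.
crossing : ∀ n {u : ℕ → ℕ} {j} → u 0 ≤ j → j < u n → ∃[ t ] u (toℕ {n} t) ≤ j × j < u (suc (toℕ t))
crossing zero        u₀≤j j<u₀ = contradiction j<u₀ (≤⇒≯ u₀≤j)
crossing (suc n) {u} {j} u₀≤j j<uₙ with j <? u 1
... | yes j<u₁ = Fin.zero , u₀≤j , j<u₁
... | no  j≮u₁ with t , u≤j , j<u ← crossing n {u ∘ suc} (≮⇒≥ j≮u₁) j<uₙ = Fin.suc t , u≤j , j<u

-- Tableaux of shape `D` as chains.

module _ (D : SkewShape) where

  private
    ν μ : Row
    ν = part (outer D)
    μ = part (inner D)

    ℓ : ℕ
    ℓ = length (parts (outer D))

    row : ℕ → List (ℕ × ℕ)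
    row i = applyUpTo (λ k → i , μ i + k) (ν i ∸ μ i)

    ν-support : ∀ i → ℓ ≤ i → ν i ≡ 0
    ν-support = parts-support (parts (outer D))

    ν↓ : ∀ {i j} → i ≤ j → ν j ≤ ν i
    ν↓ = antitone (nth-decreasing (decreasing (outer D)))

    μ↓ : ∀ {i j} → i ≤ j → μ j ≤ μ i
    μ↓ = antitone (nth-decreasing (decreasing (inner D)))

  ∈-row⁻ : ∀ {i b} → b ∈ row i → proj₁ b ≡ i × μ i ≤ proj₂ b × proj₂ b < ν i
  ∈-row⁻ {i} b∈ with k , k< , refl ← ∈-applyUpTo⁻ _ b∈ =
    refl , m≤m+n (μ i) k , subst (μ i + k <_) (m+[n∸m]≡n (inner⊆outer D i)) (+-monoʳ-< (μ i) k<)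

  ∈-boxes⁻ : ∀ {i j} → (i , j) ∈ boxes D → μ i ≤ j × j < ν i
  ∈-boxes⁻ b∈ with i , _ , b∈row ← find (∈-concatMap⁻ row {xs = upTo ℓ} b∈)
              with refl , bounds ← ∈-row⁻ b∈row = bounds

  ∈-boxes⁺ : ∀ {i j} → μ i ≤ j → j < ν i → (i , j) ∈ boxes D
  ∈-boxes⁺ {i} {j} μ≤j j<ν = ∈-concatMap⁺ row {xs = upTo ℓ} (lose (∈-upTo⁺ i<ℓ) b∈row)
    where
    i<ℓ : i < ℓ
    i<ℓ = ≰⇒> λ ℓ≤i → contradiction (subst (j <_) (ν-support i ℓ≤i) j<ν) λ ()
    b∈row : (i , j) ∈ row i
    b∈row = subst (λ k → (i , k) ∈ row i) (m+[n∸m]≡n μ≤j) (∈-applyUpTo⁺ _ (∸-monoˡ-< j<ν μ≤j))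

  boxes-unique : Unique (boxes D)
  boxes-unique = Uniqueₚ.concat⁺ {xss = List.map row (upTo ℓ)}
    (Allₚ.map⁺ (All.tabulate λ {i} _ → Uniqueₚ.applyUpTo⁺₁ _ _ λ i<j _ eq →
      <⇒≢ i<j (+-cancelˡ-≡ (μ i) _ _ (cong proj₂ eq))))
    (AllPairsₚ.map⁺ (AllPairs.map rows-disjoint (Uniqueₚ.upTo⁺ ℓ)))
    where
    rows-disjoint : ∀ {i j} → i ≢ j → Disjoint (row i) (row j)
    rows-disjoint i≢j (b∈i , b∈j) = i≢j (trans (sym (proj₁ (∈-row⁻ b∈i))) (proj₁ (∈-row⁻ b∈j)))

  Box : Set
  Box = Fin (length (boxes D))

  boxRow boxCol : Box → ℕ
  boxRow a = proj₁ (List.lookup (boxes D) a)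
  boxCol a = proj₂ (List.lookup (boxes D) a)

  box-bounds : ∀ (a : Box) → μ (boxRow a) ≤ boxCol a × boxCol a < ν (boxRow a)
  box-bounds a = ∈-boxes⁻ (∈-lookup a)

  boxAt : ∀ {i j} → μ i ≤ j → j < ν i → ∃[ a ] boxRow a ≡ i × boxCol a ≡ j
  boxAt μ≤j j<ν = Any.index b∈ , cong proj₁ (sym (lookup-index b∈)) , cong proj₂ (sym (lookup-index b∈))
    where b∈ = ∈-boxes⁺ μ≤j j<ν

  box-injective : ∀ a b → boxRow a ≡ boxRow b → boxCol a ≡ boxCol b → a ≡ b
  box-injective a b r c = lookup-injective boxes-unique a b (cong₂ _,_ r c)

  -- If `y < x`, then column `y` of row `i` is a box of `D` inside `x` but outside `y`. Comparisons
  -- of row lengths thus become questions about a single entry.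
  ≤-by-box : ∀ {i x y} → x ≤ ν i → μ i ≤ y →
    (∀ a → boxRow a ≡ i → boxCol a ≡ y → boxCol a < x → ⊥) → x ≤ y
  ≤-by-box x≤ν μ≤y noBox = ≮⇒≥ λ y<x →
    let a , r , c = boxAt μ≤y (<-≤-trans y<x x≤ν) in noBox a r c (subst (_< _) (sym c) y<x)

  private
    below? : (r : Row) → Decidable (λ (b : ℕ × ℕ) → proj₂ b < r (proj₁ b))
    below? r (i , j) = j <? r i

    -- Adding the size of `μ` avoids subtraction, and the index map `h`, which is `id` in the end,
    -- lets the induction pass to `h ∘ suc`.
    count-rows : ∀ {r : Row} → (∀ i → μ i ≤ r i) → (∀ i → r i ≤ ν i) → ∀ (h : ℕ → ℕ) m →
      length (filter (below? r) (concatMap row (applyUpTo h m))) + sum< m (μ ∘ h) ≡ sum< m (r ∘ h)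
    count-rows             μ≤r r≤ν h zero    = refl
    count-rows {r} μ≤r r≤ν h (suc m) = begin
      length (filter (below? r) (row i ++ rest)) + (μ i + Σμ)
        ≡⟨ cong (λ k → length k + (μ i + Σμ)) (filter-++ (below? r) (row i) rest) ⟩
      length (filter (below? r) (row i) ++ filter (below? r) rest) + (μ i + Σμ)
        ≡⟨ cong (_+ (μ i + Σμ)) (length-++ (filter (below? r) (row i))) ⟩
      length (filter (below? r) (row i)) + c + (μ i + Σμ)
        ≡⟨ cong (λ k → k + c + (μ i + Σμ)) in-row ⟩
      r i ∸ μ i + c + (μ i + Σμ)
        ≡⟨ solve 4 (λ x c u s → x :+ c :+ (u :+ s) := (x :+ u) :+ (c :+ s)) refl (r i ∸ μ i) c (μ i) Σμ ⟩
      r i ∸ μ i + μ i + (c + Σμ)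
        ≡⟨ cong₂ _+_ (m∸n+n≡m (μ≤r i)) (count-rows μ≤r r≤ν (h ∘ suc) m) ⟩
      r i + sum< m (r ∘ h ∘ suc)  ∎
      where
      open ≡-Reasoning
      open +-*-Solver
      i = h 0
      rest = concatMap row (applyUpTo (h ∘ suc) m)
      c = length (filter (below? r) rest)
      Σμ = sum< m (μ ∘ h ∘ suc)
      in-row : length (filter (below? r) (row i)) ≡ r i ∸ μ i
      in-row = length-filter-interval (below? r) _ (μ i) (r i) (ν i ∸ μ i)
        (subst (r i ≤_) (sym (m+[n∸m]≡n (inner⊆outer D i))) (r≤ν i)) (λ _ → id) (λ _ → id)

  -- T fills the boxes of the strip g (t+1) / g t with the entry t.
  record Code {n : ℕ} (T : Filling n D) (g : ℕ → Row) : Set where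
    field
      to   : ∀ a {t} → t ≤ n → toℕ (Vec.lookup T a) < t → boxCol a < g t (boxRow a)
      from : ∀ a {t} → t ≤ n → boxCol a < g t (boxRow a) → toℕ (Vec.lookup T a) < t

  open Code

  Between : Row → Set
  Between κ = ∀ i → μ i ≤ κ i × κ i ≤ ν i

  Code-injectiveˡ : ∀ {n} {T T′ : Filling n D} {g g′} → Code T g → Code T′ g′ → g ≗[ n ] g′ → T ≡ T′
  Code-injectiveˡ {n} {T} {T′} {g} {g′} c c′ g≗g′ = begin
    T                             ≡⟨ Vecₚ.tabulate∘lookup T ⟨
    Vec.tabulate (Vec.lookup T)   ≡⟨ Vecₚ.tabulate-cong (λ a → Finₚ.toℕ-injective
                                       (≤-antisym (le c c′ g≗g′ a) (le c′ c (λ t t≤n i → sym (g≗g′ t t≤n i)) a))) ⟩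
    Vec.tabulate (Vec.lookup T′)  ≡⟨ Vecₚ.tabulate∘lookup T′ ⟩
    T′                            ∎
    where
    open ≡-Reasoning
    le : ∀ {T T′ : Filling n D} {g g′} → Code T g → Code T′ g′ → g ≗[ n ] g′ → ∀ a →
      toℕ (Vec.lookup T a) ≤ toℕ (Vec.lookup T′ a)
    -- The threshold is one above the entry of `T′`, the first at which the box belongs to the
    -- shape.
    le {T′ = T′} c c′ g≗g′ a = s≤s⁻¹ (from c a t≤n (subst (boxCol a <_) (sym (g≗g′ _ t≤n _)) (to c′ a t≤n ≤-refl)))
      where t≤n = Finₚ.toℕ<n (Vec.lookup T′ a)

  -- A code speaks only of boxes of `D`; `Between` confines the ends of the rows to `D`, where the
  -- box in column `g′ t i` would witness a difference.
  Code-injectiveʳ : ∀ {n} {T : Filling n D} {g g′} → Code T g → Code T g′ →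
    (∀ {t} → t ≤ n → Between (g t)) → (∀ {t} → t ≤ n → Between (g′ t)) → g ≗[ n ] g′
  Code-injectiveʳ {n} {T} c c′ b b′ t t≤n i = ≤-antisym (le c c′ b b′) (le c′ c b′ b)
    where
    le : ∀ {g g′} → Code T g → Code T g′ →
      (∀ {t} → t ≤ n → Between (g t)) → (∀ {t} → t ≤ n → Between (g′ t)) → g t i ≤ g′ t i
    le c c′ b b′ = ≤-by-box (proj₂ (b t≤n i)) (proj₁ (b′ t≤n i)) λ { a refl q a<x →
      <-irrefl q (to c′ a t≤n (from c a t≤n a<x)) }

  -- The entries below `s` occupy exactly the boxes of `g s` outside `μ`, and the entries below
  -- `t + 1` are those equal to `t` and those below `t`.
  Code-size : ∀ {n} {T : Filling n D} {g} → Code T g → (∀ {t} → t ≤ n → Between (g t)) →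
    ∀ t m → ℓ ≤ m → sum< m (g (suc (toℕ t))) ≡ nth (toList (content T)) (toℕ t) + sum< m (g (toℕ t))
  Code-size {n} {T} {g} c b t m ℓ≤m = begin
    sum< m (g (suc (toℕ t)))
        ≡⟨ total t<n ⟨
    N (suc (toℕ t)) + sum< ℓ μ
        ≡⟨ cong (_+ sum< ℓ μ) (count-<-suc t T) ⟩
    Vec.count (Finₚ._≟ t) T + N (toℕ t) + sum< ℓ μ
        ≡⟨ +-assoc (Vec.count (Finₚ._≟ t) T) _ _ ⟩
    Vec.count (Finₚ._≟ t) T + (N (toℕ t) + sum< ℓ μ)
        ≡⟨ cong₂ _+_ (sym (nth-toList-tabulate (λ t → Vec.count (Finₚ._≟ t) T) t)) (total (<⇒≤ t<n)) ⟩
    nth (toList (content T)) (toℕ t) + sum< m (g (toℕ t))  ∎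
    where
    open ≡-Reasoning
    t<n = Finₚ.toℕ<n t
    N : ℕ → ℕ
    N s = Vec.count (λ x → toℕ x <? s) T
    total : ∀ {s} → s ≤ n → N s + sum< ℓ μ ≡ sum< m (g s)
    total {s} s≤n = begin
      N s + sum< ℓ μ
          ≡⟨ cong (_+ sum< ℓ μ) (count≡length-filter _ (below? (g s)) (boxes D) T (λ a → to c a s≤n , from c a s≤n)) ⟩
      length (filter (below? (g s)) (boxes D)) + sum< ℓ μ
          ≡⟨ count-rows (proj₁ ∘ b s≤n) (proj₂ ∘ b s≤n) id ℓ ⟩
      sum< ℓ (g s)
          ≡⟨ sum<-support (λ i ℓ≤i → n≤0⇒n≡0 (subst (g s i ≤_) (ν-support i ℓ≤i) (proj₂ (b s≤n i)))) ℓ≤m ⟨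
      sum< m (g s)  ∎

  chain-between : ∀ {n ℓ′ f g} → Chain n ℓ′ μ ν f g → ∀ {t} → t ≤ n → Between (g t)
  chain-between c t≤n i = Chain-start≤ c t≤n i , Chain-≤end c t≤n i

  decode : ∀ {n ℓ′ f g} → Chain n ℓ′ μ ν f g →
    ∃[ T ] Semistandard {n} D T × Code T g × (∀ {t} → t < n → nth (toList (content T)) t ≡ f t)
  decode {n} {ℓ′} {f} {g} c = T , ssyt , code , content≡
    where
    cross : ∀ a → ∃[ t ] g (toℕ {n} t) (boxRow a) ≤ boxCol a × boxCol a < g (suc (toℕ t)) (boxRow a)
    cross a = crossing n {λ t → g t (boxRow a)}
      (≤-trans (≤-reflexive (start c _)) (proj₁ (box-bounds a)))
      (<-≤-trans (proj₂ (box-bounds a)) (≤-reflexive (sym (end c _))))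

    T : Filling n D
    T = Vec.tabulate (proj₁ ∘ cross)

    T-low : ∀ a → g (toℕ (Vec.lookup T a)) (boxRow a) ≤ boxCol a
    T-low a rewrite Vecₚ.lookup∘tabulate (proj₁ ∘ cross) a = proj₁ (proj₂ (cross a))

    T-high : ∀ a → boxCol a < g (suc (toℕ (Vec.lookup T a))) (boxRow a)
    T-high a rewrite Vecₚ.lookup∘tabulate (proj₁ ∘ cross) a = proj₂ (proj₂ (cross a))

    code : Code T g
    code = record
      { to   = λ a t≤n T<t → <-≤-trans (T-high a) (Steps-mono (steps c) T<t t≤n _)
      ; from = λ a t≤n col< → ≰⇒> λ t≤T →
          <⇒≱ col< (≤-trans (Steps-mono (steps c) t≤T (<⇒≤ (Finₚ.toℕ<n (Vec.lookup T a))) _) (T-low a))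
      }

    ssyt : Semistandard D T
    ssyt a b = weak , strict
      where
      T′ = λ a → toℕ (Vec.lookup T a)
      Tb<n = Finₚ.toℕ<n (Vec.lookup T b)
      weak : boxRow a ≡ boxRow b → boxCol a < boxCol b → T′ a ≤ T′ b
      weak r a<b = s≤s⁻¹ (from code a Tb<n
        (<-trans a<b (subst (λ i → boxCol b < g (suc (T′ b)) i) (sym r) (T-high b))))
      strict : boxCol a ≡ boxCol b → boxRow a < boxRow b → T′ a < T′ b
      -- `b` lies in shape `T′ b + 1`; interlacing then puts its column inside shape `T′ b` at the
      -- higher row of `a`, so the entry of `a` is smaller.
      strict q a<b = from code a (<⇒≤ Tb<n) (subst (_< g (T′ b) (boxRow a)) (sym q) (<-≤-trans (T-high b)
        (≤-trans (antitone (λ i → ≤-trans (interlace (steps c Tb<n) i) (lower (steps c Tb<n) i)) a<b)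
                 (interlace (steps c Tb<n) (boxRow a)))))

    content≡ : ∀ {t} → t < n → nth (toList (content T)) t ≡ f t
    -- The row bound `ℓ′` of the chain may differ from that of `D`; at the larger of the two both
    -- size equations hold.
    content≡ {t} t<n = +-cancelʳ-≡ (sum< m (g t)) _ _ (trans (sym (subst
        (λ t → sum< m (g (suc t)) ≡ nth (toList (content T)) t + sum< m (g t)) (Finₚ.toℕ-fromℕ< t<n)
        (Code-size code (chain-between c) (fromℕ< t<n) m (m≤n⊔m ℓ′ ℓ))))
      (size (steps c t<n) m (m≤m⊔n ℓ′ ℓ)))
      where m = ℓ′ ⊔ ℓ

  module _ {n : ℕ} (T : Filling n D) (ssyt : Semistandard D T) where

    private
      entry : Box → ℕ
      entry a = toℕ (Vec.lookup T a)

      Threshold : ℕ → ℕ → ℕ → Set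
      Threshold t i x = ∀ a → boxRow a ≡ i → (entry a < t → boxCol a < x) × (boxCol a < x → entry a < t)

      -- Scans row `i` from the left, with `k` columns to go, up to the first entry that is at least
      -- `t`. Weak increase along the row keeps all later entries at least `t`.
      search : ∀ t i k x → x + k ≡ ν i → μ i ≤ x → (∀ a → boxRow a ≡ i → boxCol a < x → entry a < t) →
        ∃[ y ] (μ i ≤ y × y ≤ ν i) × Threshold t i y
      search t i zero x x≡ν μ≤x below = x , (μ≤x , ≤-reflexive x≡ν′) , λ { a refl →
        (λ _ → <-≤-trans (proj₂ (box-bounds a)) (≤-reflexive (sym x≡ν′))) , below a refl }
        where x≡ν′ = trans (sym (+-identityʳ x)) x≡ν
      search t i (suc k) x x+k≡ν μ≤x below
        with b , refl , refl ← boxAt μ≤x (≤-trans (m<m+n x z<s) (≤-reflexive x+k≡ν)) | entry b <? t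
      ... | yes b<t = search t i k (suc x) (trans (sym (+-suc x k)) x+k≡ν) (m≤n⇒m≤1+n μ≤x) below′
        where
        below′ : ∀ a → boxRow a ≡ i → boxCol a < suc x → entry a < t
        below′ a r (s≤s a≤x) with m≤n⇒m<n∨m≡n a≤x
        ... | inj₁ a<x = below a r a<x
        ... | inj₂ a≡x = subst (λ a → entry a < t) (sym (box-injective a b r a≡x)) b<t
      ... | no  b≮t = x , (μ≤x , ≤-trans (m≤m+n x (suc k)) (≤-reflexive x+k≡ν)) , λ a r →
        (λ a<t → ≰⇒> λ x≤a → b≮t (≤-<-trans (b≤ a r x≤a) a<t)) , below a r
        where
        b≤ : ∀ a → boxRow a ≡ i → x ≤ boxCol a → entry b ≤ entry a
        b≤ a r x≤a with m≤n⇒m<n∨m≡n x≤a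
        ... | inj₁ x<a = proj₁ (ssyt b a) (sym r) x<a
        ... | inj₂ x≡a = ≤-reflexive (cong entry (box-injective b a (sym r) x≡a))

      threshold : ∀ t i → ∃[ y ] (μ i ≤ y × y ≤ ν i) × Threshold t i y
      threshold t i = search t i (ν i ∸ μ i) (μ i) (m+[n∸m]≡n (inner⊆outer D i)) ≤-refl
        λ a r a<μ → contradiction (subst (λ i → boxCol a < μ i) (sym r) a<μ) (≤⇒≯ (proj₁ (box-bounds a)))

    code-chain : ∀ {g} → Code T g → (∀ t → Between (g t)) → Chain n ℓ μ ν (nth (toList (content T))) g
    code-chain {g} code between = record
      { start = λ i → ≤-antisym
          (≤-by-box (proj₂ (between 0 i)) ≤-refl λ { a refl _ a∈0 → contradiction (from code a z≤n a∈0) λ () })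
          (proj₁ (between 0 i))
      ; end   = λ i → ≤-antisym (proj₂ (between n i))
          (≤-by-box ≤-refl (proj₁ (between n i)) λ { a refl q _ →
            <-irrefl q (to code a ≤-refl (Finₚ.toℕ<n (Vec.lookup T a))) })
      ; steps = λ {t} t<n → record
        { lower     = λ i → ≤-by-box (proj₂ (between t i)) (proj₁ (between (suc t) i)) λ { a refl q a∈t →
            <-irrefl q (to code a t<n (m<n⇒m<1+n (from code a (<⇒≤ t<n) a∈t))) }
        ; interlace = interlaced t<n
        ; support   = λ i ℓ≤i → n≤0⇒n≡0 (subst (_ ≤_) (ν-support i ℓ≤i) (proj₂ (between (suc t) i)))
        ; size      = λ m ℓ≤m → subst
            (λ t → sum< m (g (suc t)) ≡ nth (toList (content T)) t + sum< m (g t)) (Finₚ.toℕ-fromℕ< t<n)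
            (Code-size code (λ {t} _ → between t) (fromℕ< t<n) m ℓ≤m)
        }
      }
      where
      -- Column strictness enters here. A box in column `g t i` of row `i + 1` with entry at most
      -- `t` would have a box of `D` directly above it with entry below `t`, hence inside `g t`,
      -- although its column is where row `i` of `g t` ends.
      interlaced : ∀ {t} → t < n → ∀ i → g (suc t) (suc i) ≤ g t i
      interlaced {t} t<n i = ≤-by-box (proj₂ (between (suc t) (suc i))) μ≤ noBox
        where
        μ≤ : μ (suc i) ≤ g t i
        μ≤ = ≤-trans (μ↓ (n≤1+n i)) (proj₁ (between t i))
        noBox : ∀ b → boxRow b ≡ suc i → boxCol b ≡ g t i → boxCol b < g (suc t) (suc i) → ⊥
        noBox b r q b<
          with a , ra , qa ← boxAt {i} {g t i} (proj₁ (between t i))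
                 (<-≤-trans (subst (_< _) q b<) (≤-trans (proj₂ (between (suc t) (suc i))) (ν↓ (n≤1+n i)))) =
          <-irrefl qa (subst (λ k → boxCol a < g t k) ra (to code a (<⇒≤ t<n) (<-≤-trans a<b b≤t)))
          where
          b≤t : entry b ≤ t
          b≤t = s≤s⁻¹ (from code b t<n (subst (λ k → boxCol b < g (suc t) k) (sym r) b<))
          a<b : entry a < entry b
          a<b = proj₂ (ssyt a b) (trans qa (sym q)) (subst₂ _<_ (sym ra) (sym r) ≤-refl)

    encode : ∃[ g ] Code T g × Chain n ℓ μ ν (nth (toList (content T))) g
    encode = g , code , code-chain code (λ t i → proj₁ (proj₂ (threshold t i)))
      where
      g : ℕ → Row
      g t i = proj₁ (threshold t i)
      code : Code T g
      code = record
        { to   = λ a {t} _ → proj₁ (proj₂ (proj₂ (threshold t (boxRow a))) a refl)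
        ; from = λ a {t} _ → proj₂ (proj₂ (proj₂ (threshold t (boxRow a))) a refl)
        }

-- Counting tableaux of given content.

-- The injection is a relation, since a match is found through an existentially given chain.
-- Removing `y` from `ys` is harmless: a later element matched with `y` would equal `x`, against
-- uniqueness.
length-≤ : ∀ {A B : Set} {xs : List A} {ys : List B} (_~_ : A → B → Set) → Unique xs →
  (∀ {x} → x ∈ xs → ∃[ y ] y ∈ ys × x ~ y) → (∀ {x x′ y} → x ~ y → x′ ~ y → x ≡ x′) →
  length xs ≤ length ys
length-≤ {xs = []}              _~_ _           _     _   = z≤n
length-≤ {xs = x ∷ xs} {ys = _} _~_ (x∉ ∷ uniq) total inj
  with y , y∈ , x~y ← total (here refl)
  with as , bs , refl ← ∈-∃++ y∈ = begin
    suc (length xs)                ≤⟨ s≤s (length-≤ _~_ uniq total′ inj) ⟩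
    suc (length (as ++ bs))        ≡⟨ cong suc (length-++ as) ⟩
    suc (length as + length bs)    ≡⟨ +-suc (length as) (length bs) ⟨
    length as + suc (length bs)    ≡⟨ length-++ as ⟨
    length (as ++ y ∷ bs)          ∎
  where
  open ≤-Reasoning
  total′ : ∀ {x′} → x′ ∈ xs → ∃[ y′ ] y′ ∈ as ++ bs × x′ ~ y′
  total′ x′∈ with y′ , y′∈ , x′~y′ ← total (there x′∈) | ∈-++⁻ as y′∈
  ... | inj₁ y′∈as         = y′ , ∈-++⁺ˡ y′∈as , x′~y′
  ... | inj₂ (here refl)   = contradiction (inj x~y x′~y′) (All.lookup x∉ x′∈)
  ... | inj₂ (there y′∈bs) = y′ , ∈-++⁺ʳ as y′∈bs , x′~y′

words-complete : ∀ {n m} (w : Vec (Fin n) m) → w ∈ words n m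
words-complete []      = here refl
words-complete (x ∷ w) = ∈-cartesianProductWith⁺ _∷_ (∈-allFin x) (words-complete w)

words-unique : ∀ n m → Unique (words n m)
words-unique n zero    = [] ∷ []
words-unique n (suc m) = Uniqueₚ.cartesianProductWith⁺ _∷_ Vecₚ.∷-injective (Uniqueₚ.allFin⁺ n) (words-unique n m)

-- The test has the same orientation as in `monomial`, so coefficient and filter reduce together.
tableauxOf : ∀ {n} (D : SkewShape) → Exponent n → List (Filling n D)
tableauxOf D α = filter (λ T → α ≟ᵉ content T) (tableaux _ D)

∈-tableauxOf⁺ : ∀ {n} D {α : Exponent n} {T} → Semistandard D T → α ≡ content T → T ∈ tableauxOf D α
∈-tableauxOf⁺ D {T = T} ssyt α≡ = ∈-filter⁺ _ (∈-filter⁺ (semistandard? D) (words-complete T) ssyt) α≡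

∈-tableauxOf⁻ : ∀ {n} D {α : Exponent n} {T} → T ∈ tableauxOf D α → Semistandard D T × α ≡ content T
∈-tableauxOf⁻ {n} D {α} T∈
  with T∈tableaux , α≡ ← ∈-filter⁻ (λ T → α ≟ᵉ content T) {xs = tableaux n D} T∈
  = proj₂ (∈-filter⁻ (semistandard? D) {xs = words n (length (boxes D))} T∈tableaux) , α≡

tableauxOf-unique : ∀ {n} D (α : Exponent n) → Unique (tableauxOf D α)
tableauxOf-unique D α = Uniqueₚ.filter⁺ _ (Uniqueₚ.filter⁺ (semistandard? D) (words-unique _ _))

fromℕ : ℕ → ℚ
fromℕ zero    = 0ℚ
fromℕ (suc k) = 1ℚ ℚ.+ fromℕ k

coeff-schur : ∀ n D α → coeff (schur n D) α ≡ fromℕ (length (tableauxOf D α))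
coeff-schur n D α = go (tableaux n D)
  where
  go : ∀ Ts → coeff (sumᴾ (List.map (λ T → monomial (content T)) Ts)) α
            ≡ fromℕ (length (filter (λ T → α ≟ᵉ content T) Ts))
  go []       = refl
  go (T ∷ Ts) with ih ← go Ts | α ≟ᵉ content T
  ... | yes _ = cong (1ℚ ℚ.+_) ih
  ... | no _  = trans (ℚₚ.+-identityˡ _) ih

coeff-schur≡0 : ∀ n D α → (∀ T → Semistandard D T → α ≢ content T) → coeff (schur n D) α ≡ 0ℚ
coeff-schur≡0 n D α none = trans (coeff-schur n D α) (empty (tableauxOf D α) λ {T} T∈ →
  let ssyt , α≡ = ∈-tableauxOf⁻ D {T = T} T∈ in none T ssyt α≡)
  where
  empty : ∀ {A : Set} (xs : List A) → (∀ {x} → ¬ (x ∈ xs)) → fromℕ (length xs) ≡ 0ℚ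
  empty []      _  = refl
  empty (x ∷ _) x∉ = contradiction (here refl) x∉

entry : ∀ {n} → Exponent n → ℕ → ℕ
entry α = nth (toList α)

entry-ext : ∀ {n} {α β : Exponent n} → (∀ {t} → t < n → entry α t ≡ entry β t) → α ≡ β
entry-ext {α = []}    {[]}    eq = refl
entry-ext {α = _ ∷ _} {_ ∷ _} eq = cong₂ _∷_ (eq z<s) (entry-ext (λ t<n → eq (s<s t<n)))

entry-∸ : ∀ {n R} (α : Exponent n) {t} → t < n → entry (Vec.replicate n R ∸ᵉ α) t ≡ R ∸ entry α t
entry-∸ (_ ∷ α) {zero}  _         = refl
entry-∸ (_ ∷ α) {suc t} (s<s t<n) = entry-∸ α t<n

entry-≤ : ∀ {n R} {α : Exponent n} → α ≤ᵉ Vec.replicate n R → ∀ t → entry α t ≤ R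
entry-≤ []       t       = z≤n
entry-≤ (p ∷ ps) zero    = p
entry-≤ (p ∷ ps) (suc t) = entry-≤ ps t

≤ᵉ-entry : ∀ {n R} {α : Exponent n} → (∀ {t} → t < n → entry α t ≤ R) → α ≤ᵉ Vec.replicate n R
≤ᵉ-entry {α = []}    _  = []
≤ᵉ-entry {α = _ ∷ _} ≤R = ≤R z<s ∷ ≤ᵉ-entry (λ t<n → ≤R (s<s t<n))

-- Each exponent of a tableau is the size of a strip, hence at most the first row of some shape in
-- the chain.
schur-bounded : ∀ n {R} D → part (outer D) 0 ≤ R → ∀ α → ¬ α ≤ᵉ Vec.replicate n R → coeff (schur n D) α ≡ 0ℚ
schur-bounded n D ν₀≤R α α≰κ = coeff-schur≡0 n D α λ { T ssyt refl →
  let g , _ , chain = encode D T ssyt in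
  α≰κ (≤ᵉ-entry λ t<n → ≤-trans (size≤first (steps chain t<n)) (≤-trans (Chain-≤end chain t<n 0) ν₀≤R)) }

-- No tableau is extracted from nonvanishing. Instead, a failure of the bound gives a column with
-- more than `n` boxes, which excludes every tableau and makes all coefficients zero.
column-bound : ∀ n D → schur n D ≉0 → ∀ i → part (outer D) (n + i) ≤ part (inner D) i
column-bound n D s≉0 i = decidable-stable (_ ≤? _) λ ν≰μ → s≉0 λ α → coeff-schur≡0 n D α λ T ssyt _ →
  let g , _ , chain = encode D T ssyt in ν≰μ (begin
    part (outer D) (n + i)   ≡⟨ end chain (n + i) ⟨
    g n (n + i)              ≡⟨ cong (λ k → g k (n + i)) (+-identityʳ n) ⟨
    g (n + 0) (n + i)        ≤⟨ Steps-interlace (steps chain) n (≤-reflexive (+-identityʳ n)) i ⟩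
    g 0 i                    ≡⟨ Chain.start chain i ⟩
    part (inner D) i         ∎)
  where open ≤-Reasoning

-- Encode, apply `Φ`, decode. The target bound `ℓ` is free because `Φ` may change the number of
-- rows; injectivity is needed only on chains of the source.
transfer : ∀ {n ℓ} D E {α β : Exponent n} (Φ : (ℕ → Row) → ℕ → Row) →
  let Source = Chain n (length (parts (outer D))) (part (inner D)) (part (outer D)) (entry α) in
  (∀ {g} → Source g → Chain n ℓ (part (inner E)) (part (outer E)) (entry β) (Φ g)) →
  (∀ {g h} → Source g → Source h → Φ g ≗[ n ] Φ h → g ≗[ n ] h) →
  length (tableauxOf D α) ≤ length (tableauxOf E β)
transfer {n} D E {α} {β} Φ Φ-chain Φ-injective = length-≤ _~_ (tableauxOf-unique D α) total injective
  where
  Source : (ℕ → Row) → Set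
  Source = Chain n (length (parts (outer D))) (part (inner D)) (part (outer D)) (entry α)

  _~_ : Filling n D → Filling n E → Set
  T ~ T′ = ∃[ g ] Source g × Code D T g × Code E T′ (Φ g)

  total : ∀ {T} → T ∈ tableauxOf D α → ∃[ T′ ] T′ ∈ tableauxOf E β × T ~ T′
  total {T} T∈ with ssyt , refl ← ∈-tableauxOf⁻ D T∈
           with g , code , chain ← encode D T ssyt
           with T′ , ssyt′ , code′ , content≡ ← decode E (Φ-chain chain)
    = T′ , ∈-tableauxOf⁺ E ssyt′ (sym (entry-ext content≡)) , g , chain , code , code′

  injective : ∀ {T U T′} → T ~ T′ → U ~ T′ → T ≡ U
  injective (g , gs , gT , gT′) (h , hs , hU , hT′) = Code-injectiveˡ D gT hU
    (Φ-injective gs hs (Code-injectiveʳ E gT′ hT′ (chain-between E (Φ-chain gs)) (chain-between E (Φ-chain hs))))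

Chain-resp : ∀ {n ℓ μ ν f f′ g} → (∀ {t} → t < n → f t ≡ f′ t) → Chain n ℓ μ ν f g → Chain n ℓ μ ν f′ g
Chain-resp f≡f′ c = record
  { start = start c
  ; end   = end c
  ; steps = λ t<n → Step-resp (λ _ → refl) (λ _ → refl) (f≡f′ t<n) (steps c t<n)
  }

-- Coefficients of the complement.

module _ {n R : ℕ} (D : SkewShape) (1≤R : 1 ≤ R) (ν₀≤R : part (outer D) 0 ≤ R) (μ₀≤R : part (inner D) 0 ≤ R)
         (c : outer D ⊆ rect n R (inner D) 1≤R μ₀≤R) where

  private
    E : SkewShape
    E = complement n R D 1≤R μ₀≤R c

    κ : Exponent n
    κ = Vec.replicate n R

    xs : List ℕ
    xs = parts (inner D)

    reverse-index : ∀ {t} → t < n → n ∸ suc (n ∸ suc t) ≡ t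
    reverse-index {t} t<n = trans (cong (n ∸_) (sym (+-∸-assoc 1 t<n))) (m∸[m∸n]≡n (<⇒≤ t<n))

  -- In both directions the Bender-Knuth reversal acts on chains of `D`, so that the content is
  -- reversed twice in all. On the way back, `α ≤ κ` is what makes `R ∸ (R ∸ f t)` equal `f t`.
  tableauxOf-complement : ∀ {α} → α ≤ᵉ κ → length (tableauxOf D α) ≡ length (tableauxOf E (κ ∸ᵉ α))
  tableauxOf-complement {α} α≤κ = ≤-antisym
    (transfer D E (complementᶜ R n ∘ reversal n f)
      (λ s → Chain-resp (λ t<n → trans (cong (λ k → R ∸ f k) (reverse-index t<n)) (sym (entry-∸ α t<n)))
        (complementᶜ-chain R xs ν₀≤R (reversal-chain n f s)))
      (λ s s′ eq → reversal-injective n f s s′ (complementᶜ-injective R n eq)))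
    (transfer E D (reversal n f″ ∘ uncomplement n)
      (λ s → Chain-resp (λ t<n → begin
          R ∸ f′ (n ∸ suc (n ∸ suc _))  ≡⟨ cong (λ k → R ∸ f′ k) (reverse-index t<n) ⟩
          R ∸ f′ _                      ≡⟨ cong (R ∸_) (entry-∸ α t<n) ⟩
          R ∸ (R ∸ f _)                 ≡⟨ m∸[m∸n]≡n (entry-≤ α≤κ _) ⟩
          f _                           ∎)
        (reversal-chain n f″ (uncomplement-chain xs s)))
      (λ s s′ eq → uncomplement-injective xs s s′
        (reversal-injective n f″ (uncomplement-chain xs s) (uncomplement-chain xs s′) eq)))
    where
    open ≡-Reasoning
    f f′ f″ : ℕ → ℕ
    f    = entry α
    f′   = entry (κ ∸ᵉ α)
    f″ t = R ∸ f′ (n ∸ suc t)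

  coeff-complement : ∀ {α} → α ≤ᵉ κ → coeff (schur n D) α ≡ coeff (schur n E) (κ ∸ᵉ α)
  coeff-complement {α} α≤κ = begin
    coeff (schur n D) α                        ≡⟨ coeff-schur n D α ⟩
    fromℕ (length (tableauxOf D α))            ≡⟨ cong fromℕ (tableauxOf-complement α≤κ) ⟩
    fromℕ (length (tableauxOf E (κ ∸ᵉ α)))     ≡⟨ coeff-schur n E (κ ∸ᵉ α) ⟨
    coeff (schur n E) (κ ∸ᵉ α)                 ∎
    where open ≡-Reasoning

  schur-reciprocal : schur n D ≈ reciprocal κ (schur n E)
  schur-reciprocal α with α ≤ᵉ? κ
  ... | yes α≤κ = coeff-complement α≤κ
  ... | no  α≰κ = schur-bounded n D ν₀≤R α α≰κ

  schur-complement≉0 : schur n D ≉0 → schur n E ≉0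
  schur-complement≉0 s≉0 E≈0 = s≉0 λ α → trans (schur-reciprocal α) (reciprocal-0 α)
    where
    reciprocal-0 : reciprocal κ (schur n E) ≈ 0ᴾ
    reciprocal-0 α with α ≤ᵉ? κ
    ... | yes _ = E≈0 (κ ∸ᵉ α)
    ... | no  _ = refl

  schur-complement-bounded : ∀ α → α ∈supp schur n E → α ≤ᵉ κ
  schur-complement-bounded α α∈ = decidable-stable (α ≤ᵉ? κ) λ α≰κ → α∈ (schur-bounded n E (first≤R n) α α≰κ)
    where
    first≤R : ∀ n → nth (List.replicate n R ++ xs) 0 ≤ R
    first≤R zero    = μ₀≤R
    first≤R (suc n) = ≤-refl

corollary3p2 : (ν μ : Partition) (μ⊆ν : μ ⊆ ν) (ν≢∅ : ν ≢ ∅)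
    (n : ℕ) .{{_ : NonZero n}} →
    schur n (skew ν μ μ⊆ν) ≉0 →
    (R : ℕ) (ν₁≤R : part ν 0 ≤ R) →
    let D    = skew ν μ μ⊆ν
        1≤R  = ≢∅⇒1≤ ν≢∅ ν₁≤R
        μ₁≤R = ≤-trans (μ⊆ν 0) ν₁≤R
        κ    = replicate n R
    in
    Σ[ ν⊆Rⁿμ ∈ ν ⊆ rect n R μ 1≤R μ₁≤R ]
      let E = complement n R D 1≤R μ₁≤R ν⊆Rⁿμ in
      (schur n E ≉0) ×
      (∀ α → α ∈supp schur n E → α ≤ᵉ κ) ×
      (normalize (schur n D) ≈ dual κ (schur n E))
corollary3p2 ν μ μ⊆ν ν≢∅ n s≉0 R ν₁≤R =
  ν⊆Rⁿμ ,
  schur-complement≉0 D 1≤R ν₁≤R μ₁≤R ν⊆Rⁿμ s≉0 ,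
  schur-complement-bounded D 1≤R ν₁≤R μ₁≤R ν⊆Rⁿμ ,
  (λ α → cong (ℚ._* _) (schur-reciprocal D 1≤R ν₁≤R μ₁≤R ν⊆Rⁿμ α))
  where
  D    = skew ν μ μ⊆ν
  1≤R  = ≢∅⇒1≤ ν≢∅ ν₁≤R
  μ₁≤R = ≤-trans (μ⊆ν 0) ν₁≤R

  ν⊆Rⁿμ : ν ⊆ rect n R μ 1≤R μ₁≤R
  ν⊆Rⁿμ i with i <? n
  ... | yes i<n = begin
    part ν i                                  ≤⟨ antitone (nth-decreasing (decreasing ν)) z≤n ⟩
    part ν 0                                  ≤⟨ ν₁≤R ⟩
    R                                         ≡⟨ nth-replicate-< n (parts μ) i<n ⟨
    nth (List.replicate n R ++ parts μ) i     ∎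
    where open ≤-Reasoning
  -- Below the rectangle, row `i` of `ν` must fit into row `i ∸ n` of `μ`, which is the bound on
  -- column lengths.
  ... | no  i≮n = subst (λ i → part ν i ≤ nth (List.replicate n R ++ parts μ) i) (m+[n∸m]≡n (≮⇒≥ i≮n)) (begin
    part ν (n + (i ∸ n))                                ≤⟨ column-bound n D s≉0 (i ∸ n) ⟩
    part μ (i ∸ n)                                      ≡⟨ nth-replicate-+ n (parts μ) (i ∸ n) ⟨
    nth (List.replicate n R ++ parts μ) (n + (i ∸ n))   ∎)
    where open ≤-Reasoning
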